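{- Let $m,n$ be positive integers with $m<2^n$. Consider the following game. Kronecker holds a list of $m$ vectors $v_1,\ldots,v_m\in\{0,1\}^n$, unknown to Cantor. Cantor must declare in advance (obliviously, before receiving any answer) a set of queries, each of the form ``what is bit number $j$ of vector number $i$?'' (for $1\le i\le m$, $1\le j\le n$); Kronecker then answers all of them truthfully, and Cantor must output a vector $u\in\{0,1\}^n$ with $u\neq v_i$ for all $1\le i\le m$. Let $f(n,m)$ be the smallest number $q$ such that there is a set of at most $q$ queries with which Cantor can, for every list $v_1,\ldots,v_m$, output such a vector $u$ (as a function of the answers). Then, with all logarithms to base $2$, \[ f(n,m)=\begin{cases} m & \text{if } m\le n,\\ m\Bigl(\log\bigl\lceil \tfrac{m}{n}\bigr\rceil + o\bigl(\log\bigl\lceil\tfrac mn\bigr\rceil\bigr)\Bigr) & \text{if } n<m<2^n.\end{cases} \] Quantitatively, for all $n<m<2^n$, \[ m\Bigl(\log\Bigl(\frac{m}{n-\log m+1}\Bigr)-1\Bigr)\;\le\; f(n,m)\;\le\; m\Bigl\lceil \log\Bigl(\frac{2m}{n}\Bigr)+2\log\Bigl(\log\Bigl(\frac{2m}{n}\Bigr)\Bigr)+1\Bigr\rceil . \] -}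

module Defs where

open import Data.Bool using (Bool; true; false; if_then_else_)
open import Data.Nat as ℕ using (ℕ; zero; suc; _≤_; _<_; _*_; _^_)
open import Data.Nat.DivMod using (_/_)
open import Data.Fin using (Fin)
open import Data.List using (List; map; allFin)
open import Data.Nat.ListAction using (sum)
open import Data.Integer as ℤ using (ℤ; +_; -[1+_])
open import Data.Rational as ℚ using (ℚ; ↥_; ↧ₙ_)
open import Data.Product using (Σ; ∃; _×_)
open import Relation.Binary.PropositionalEquality using (_≡_)
open import Relation.Nullary using (¬_)

Lists : ℕ → ℕ → Set
Lists m n = Fin m → Fin n → Bool

QuerySet : ℕ → ℕ → Set
QuerySet m n = Fin m → Fin n → Bool

size : ∀ {m n} → QuerySet m n → ℕ
size {m} {n} Q =
  sum (map (λ i → sum (map (λ j → if Q i j then 1 else 0) (allFin n))) (allFin m))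

SameAnswers : ∀ {m n} → QuerySet m n → Lists m n → Lists m n → Set
SameAnswers Q v w = ∀ i j → Q i j ≡ true → v i j ≡ w i j

DependsOnlyOnAnswers : ∀ {m n} → QuerySet m n → (Lists m n → Fin n → Bool) → Set
DependsOnlyOnAnswers {m} {n} Q out =
  ∀ (v w : Lists m n) → SameAnswers Q v w → ∀ j → out v j ≡ out w j

AlwaysWins : ∀ {m n} → (Lists m n → Fin n → Bool) → Set
AlwaysWins {m} {n} out = ∀ (v : Lists m n) (i : Fin m) → ¬ (∀ j → out v j ≡ v i j)

Solvable : ℕ → ℕ → ℕ → Set
Solvable n m q =
  Σ (QuerySet m n) λ Q → size Q ≤ q ×
    Σ (Lists m n → Fin n → Bool) λ out → DependsOnlyOnAnswers Q out × AlwaysWins out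

IsF : ℕ → ℕ → ℕ → Set
IsF n m k = Solvable n m k × (∀ q → Solvable n m q → k ≤ q)

-- Comparisons with powers of 2 with rational exponent (no reals in stdlib).
-- For x = p/d (d > 0, p ∈ ℤ) and positive rationals c, y:
--   c·2^x ≤ y  ⇔  c^d·2^p ≤ y^d     (and likewise for <, and y ≤ 2^x).

_^ℚ_ : ℚ → ℕ → ℚ
x ^ℚ zero = ℚ.1ℚ
x ^ℚ suc k = x ℚ.* (x ^ℚ k)

nℚ : ℕ → ℚ
nℚ k = + k ℚ./ 1

-- c · 2^x ≤ y
Pow2≤ : ℚ → ℚ → ℚ → Set
Pow2≤ c x y with ↥ x
... | + k      = (c ^ℚ (↧ₙ x)) ℚ.* (nℚ 2 ^ℚ k) ℚ.≤ (y ^ℚ (↧ₙ x))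
... | -[1+ k ] = (c ^ℚ (↧ₙ x)) ℚ.≤ (y ^ℚ (↧ₙ x)) ℚ.* (nℚ 2 ^ℚ suc k)

-- c · 2^x < y
Pow2< : ℚ → ℚ → ℚ → Set
Pow2< c x y with ↥ x
... | + k      = (c ^ℚ (↧ₙ x)) ℚ.* (nℚ 2 ^ℚ k) ℚ.< (y ^ℚ (↧ₙ x))
... | -[1+ k ] = (c ^ℚ (↧ₙ x)) ℚ.< (y ^ℚ (↧ₙ x)) ℚ.* (nℚ 2 ^ℚ suc k)

-- y ≤ 2^x
≤Pow2 : ℚ → ℚ → Set
≤Pow2 y x with ↥ x
... | + k      = (y ^ℚ (↧ₙ x)) ℚ.≤ (nℚ 2 ^ℚ k)
... | -[1+ k ] = (y ^ℚ (↧ₙ x)) ℚ.* (nℚ 2 ^ℚ suc k) ℚ.≤ ℚ.1ℚ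

-- "m (log(m/(n − log m + 1)) − 1) ≤ q".
-- With t = log m the left side is L(t) = m (t − log(n+1−t) − 1), which is
-- continuous and strictly increasing on t < n+1; hence L(log m) ≤ q iff
-- L(r) ≤ q for all rationals r < log m (i.e. 2^r < m), and
--   L(r) ≤ q  ⇔  2^(m(r−1) − q) ≤ (n+1−r)^m.
LowerBoundHolds : ℕ → ℕ → ℕ → Set
LowerBoundHolds n m q =
  ∀ (r : ℚ) → Pow2< ℚ.1ℚ r (nℚ m) →
    Pow2≤ ℚ.1ℚ (nℚ m ℚ.* (r ℚ.- ℚ.1ℚ) ℚ.- nℚ q) ((nℚ (suc n) ℚ.- r) ^ℚ m)

-- "⌈ log(2m/n) + 2 log(log(2m/n)) + 1 ⌉ ≤ K", for n < m (so w = log(2m/n) > 1).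
-- Equivalently u ≤ K with u = w + 2 log w + 1, which (u being continuous and
-- increasing in w) holds iff r + 2 log r + 1 ≤ K for all rationals 1 < r < w,
-- where r < w ⇔ n·2^r < 2m, and r + 2 log r + 1 ≤ K ⇔ r² ≤ 2^(K − 1 − r).
CeilUpperAtMost : ℕ → ℕ → ℕ → Set
CeilUpperAtMost n m K =
  ∀ (r : ℚ) → ℚ.1ℚ ℚ.< r → Pow2< (nℚ n) r (nℚ (2 * m)) →
    ≤Pow2 (r ℚ.* r) (nℚ K ℚ.- ℚ.1ℚ ℚ.- r)

ceilDiv : ℕ → ℕ → ℕ
ceilDiv m zero = 0
ceilDiv m (suc n) = (m ℕ.+ n) / suc n

{-# OPTIONS --safe #-}

-- Upper bound: cut the columns into q = ⌊n/K⌋ blocks of K and the rows into q groups of fewer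
-- than 2^K. A group is queried only in its own block, so some pattern of that block differs
-- from all of its rows, and concatenating these patterns wins. Since n/q ≤ 2K − 1, this works
-- whenever (2K − 1) m ≤ n (2^K − 1). Otherwise log(2m/n) is so large that a rational r below it
-- has r² > 2^(K−1−r), so K is not an upper bound for log(2m/n) + 2 log log(2m/n) + 1.
--
-- Lower bound: Kronecker answers the lighter half of the rows greedily. A row with d queries can
-- be made to match a fraction 2^(−d) of the points not matched so far, so that about
-- 2^n ∏ (1 − 2^(−d)) ≤ 2^(n − Σ 2^(−d)) points remain; every other row can match one more point,
-- hence more than m/2 points must remain. Therefore Σ 2^(−d) ≤ n + 1 − log m, and by the
-- inequality of arithmetic and geometric means the sum is at least (m/2) 2^(−q/m).
module Submission where

open import Defs
open import Data.Bool using (Bool; true; false; if_then_else_; not; _∧_; T)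
open import Data.Bool.Properties using (T?) renaming (_≟_ to _≟ᵇ_)
open import Data.Fin using (Fin; zero; suc; toℕ; fromℕ<)
open import Data.Fin.Properties using (toℕ<n; toℕ-fromℕ<; fromℕ<-toℕ; toℕ-injective)
open import Data.Integer using (-[1+_])
import Data.Integer as ℤ
import Data.Integer.Properties as ℤ
open import Data.List using (List; []; _∷_; _++_; map; length; allFin; tabulate; filterᵇ)
open import Data.List.Membership.Propositional using (_∈_; _∉_)
open import Data.List.Membership.Propositional.Properties using (∈-tabulate⁺; ∈-filter⁺; ∈-map⁺; ∈-++⁺ˡ; ∈-++⁺ʳ)
open import Data.List.Properties using (map-tabulate; length-tabulate; tabulate-cong; length-++; length-map; map-++; ∷-injective; ++-identityʳ)
open import Data.List.Relation.Binary.Permutation.Propositional using (_↭_; ↭-refl; ↭-sym; ↭-trans; ↭-reflexive; prep; swap)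
open import Data.List.Relation.Binary.Permutation.Propositional.Properties using (All-resp-↭; Any-resp-↭; ↭-length; ↭-map-inv; map⁺; shift)
open import Data.List.Relation.Unary.All as All using (All; []; _∷_)
open import Data.List.Relation.Unary.All.Properties using (++⁻ˡ)
open import Data.List.Relation.Unary.Any using (Any; here; there)
open import Data.List.Relation.Unary.Any.Properties using (++⁺ˡ; ++⁺ʳ; tabulate⁻)
open import Data.Nat using (ℕ; zero; suc; _≤_; _<_; _*_; _+_; _∸_; _^_; z≤n; s≤s; s≤s⁻¹; NonZero; >-nonZero; ⌊_/2⌋; ⌈_/2⌉)
open import Data.Nat.Coprimality using (Coprime)
open import Data.Nat.DivMod using (_/_; _%_; _mod_; m%n<n; m≡m%n+[m/n]*n; m/n*n≤m; m≥n⇒m/n>0; m*n/n≡m; m<n⇒m/n≡0; m<n*o⇒m/o<n; m<n⇒m%n≡m; [m+kn]%n≡m%n; +-distrib-/-∣ˡ; /-monoˡ-≤)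
open import Data.Nat.Divisibility using (n∣m*n)
open import Data.Nat.ListAction using (sum; product)
open import Data.Nat.ListAction.Properties using (sum-↭)
open import Data.Nat.Properties
open import Data.Nat.Tactic.RingSolver using (solve-∀)
open import Data.Product using (∃; ∃₂; _×_; _,_; proj₁; proj₂)
open import Data.Rational using (ℚ; mkℚ; 1ℚ; fromℚᵘ; toℚᵘ; Positive)
import Data.Rational as ℚ
import Data.Rational.Properties as ℚ
open import Data.Rational.Solver using (module +-*-Solver)
open import Data.Rational.Unnormalised using (mkℚᵘ; *≡*; *≤*; *<*)
import Data.Rational.Unnormalised as ℚᵘ
import Data.Rational.Unnormalised.Properties as ℚᵘ
open import Data.Sum using (_⊎_; inj₁; inj₂; [_,_]′)
open import Data.Unit using (tt)
open import Data.Vec as Vec using (Vec; []; _∷_)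
import Data.Vec.Functional as VecF
open import Data.Vec.Properties using (lookup∘tabulate; tabulate∘lookup) renaming (tabulate-cong to vtabulate-cong)
open import Function using (_∘_; id)
open import Relation.Binary.PropositionalEquality
open import Relation.Nullary using (¬_; Dec; yes; no; does; contradiction)
open import Relation.Nullary.Decidable using (dec-true; from-no)

-- If all rows were answered greedily, a single surviving point would already contradict nothing,
-- and only Σ 2^(-d) ≤ n, hence log(m/n), would follow. Sparing half of the rows forces more than
-- about m/2 survivors: this brings the gain log m in n + 1 - log m and costs the term -1, since
-- only half of the rows enter the sum. Taking the lighter half keeps its average number of queries
-- at most q/m. No real numbers occur. A factor 1 - 1/D with D = 2^d is controlled by its D-th
-- power, which is at most 1/2; as D divides 2^n, all estimates are raised to the common power 2^n
-- and multiplied. Sums of 2^(-d) are scaled by 2^n as well. For the upper bound, m/n > (2^K -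
-- 1)/(2K - 1) places log(2m/n) above K - ⌈log K⌉, and the square of that number far exceeds 2^(⌈log
-- K⌉ - 1). The room is a factor of order K, so an integer r serves once K is not tiny.

-- Powers, Bernoulli's inequality, arithmetic and geometric means.

^-distribʳ-* : ∀ k a b → (a * b) ^ k ≡ a ^ k * b ^ k
^-distribʳ-* zero    a b = refl
^-distribʳ-* (suc k) a b = trans (cong (a * b *_) (^-distribʳ-* k a b)) (interchange a b (a ^ k) (b ^ k))
  where
  interchange : ∀ a b x y → a * b * (x * y) ≡ a * x * (b * y)
  interchange = solve-∀

^-swap : ∀ a i j → (a ^ i) ^ j ≡ (a ^ j) ^ i
^-swap a i j = trans (^-*-assoc a i j) (trans (cong (a ^_) (*-comm i j)) (sym (^-*-assoc a j i)))

^-cancelʳ-≤ : ∀ k .{{_ : NonZero k}} {a b} → a ^ k ≤ b ^ k → a ≤ b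
^-cancelʳ-≤ k a^k≤b^k = ≮⇒≥ λ b<a → <⇒≱ (^-monoˡ-< k b<a) a^k≤b^k

^-cancelʳ-< : ∀ k {a b} → a ^ k < b ^ k → a < b
^-cancelʳ-< k a^k<b^k = ≰⇒> λ b≤a → <⇒≱ a^k<b^k (^-monoˡ-≤ k b≤a)

^-cancelˡ-≤ : ∀ a → 1 < a → ∀ {i j} → a ^ i ≤ a ^ j → i ≤ j
^-cancelˡ-≤ a 1<a a^i≤a^j = ≮⇒≥ λ j<i → <⇒≱ (^-monoʳ-< a 1<a j<i) a^i≤a^j

1≤2^ : ∀ k → 1 ≤ 2 ^ k
1≤2^ = m^n>0 2

-- These are the first two terms of the binomial expansion; the homogeneous form avoids division.
bernoulli : ∀ k y z → y ^ suc k + suc k * (y ^ k * z) ≤ (y + z) ^ suc k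
bernoulli zero    y z = ≤-reflexive (lemma y z)
  where
  lemma : ∀ y z → y * 1 + 1 * (1 * z) ≡ (y + z) * 1
  lemma = solve-∀
bernoulli (suc k) y z = begin
  y * (y * Y) + suc (suc k) * (y * Y * z)
    ≤⟨ m≤m+n _ _ ⟩
  y * (y * Y) + suc (suc k) * (y * Y * z) + z * (suc k * (Y * z))
    ≡⟨ lemma k y z Y ⟩
  (y + z) * (y * Y + suc k * (Y * z))
    ≤⟨ *-monoʳ-≤ (y + z) (bernoulli k y z) ⟩
  (y + z) * (y + z) ^ suc k ∎
  where
  open ≤-Reasoning
  Y = y ^ k
  lemma : ∀ k y z Y → y * (y * Y) + (2 + k) * (y * Y * z) + z * ((1 + k) * (Y * z))
                      ≡ (y + z) * (y * Y + (1 + k) * (Y * z))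
  lemma = solve-∀

-- (1 − 1/D)^D ≤ 1/2
shrink-halves : ∀ D .{{_ : NonZero D}} {x y} → x + D * y ≤ D * x → 2 * y ^ D ≤ x ^ D
shrink-halves D@(suc k) {x} {y} le
  with z , refl ← m≤n⇒∃[o]m+o≡n {y} {x} (*-cancelˡ-≤ D (≤-trans (m≤n+m (D * y) x) le)) = begin
  2 * (y * y ^ k)                    ≡⟨ cong (y ^ D +_) (+-identityʳ _) ⟩
  y ^ D + y * y ^ k                  ≤⟨ +-monoʳ-≤ (y ^ D) (*-monoˡ-≤ (y ^ k) y≤Dz) ⟩
  y ^ D + D * z * y ^ k              ≡⟨ cong (y ^ D +_) (trans (*-assoc D z (y ^ k)) (cong (D *_) (*-comm z (y ^ k)))) ⟩
  y ^ D + D * (y ^ k * z)            ≤⟨ bernoulli k y z ⟩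
  (y + z) ^ D                        ∎
  where
  open ≤-Reasoning
  y≤Dz : y ≤ D * z
  y≤Dz = ≤-trans (m≤m+n y z) (+-cancelʳ-≤ (D * y) _ _
    (≤-trans le (≤-reflexive (trans (*-distribˡ-+ D y z) (+-comm (D * y) (D * z))))))

2xy≤x²+y² : ∀ x y → 2 * (x * y) ≤ x * x + y * y
2xy≤x²+y² x y with ≤-total x y
... | inj₁ x≤y with d , refl ← m≤n⇒∃[o]m+o≡n x≤y =
  ≤-trans (m≤m+n _ (d * d)) (≤-reflexive (lemma x d))
  where
  lemma : ∀ x d → 2 * (x * (x + d)) + d * d ≡ x * x + (x + d) * (x + d)
  lemma = solve-∀
... | inj₂ y≤x with d , refl ← m≤n⇒∃[o]m+o≡n y≤x =
  ≤-trans (m≤m+n _ (d * d)) (≤-reflexive (lemma y d))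
  where
  lemma : ∀ y d → 2 * ((y + d) * y) + d * d ≡ (y + d) * (y + d) + y * y
  lemma = solve-∀

-- Bernoulli's inequality (y/x)^(k+1) ≥ 1 + (k+1)(y/x − 1) without subtraction.
tangent : ∀ k x y → suc k * (y * x ^ k) ≤ y ^ suc k + k * x ^ suc k
tangent zero    x y = ≤-reflexive (lemma y)
  where
  lemma : ∀ y → 1 * (y * 1) ≡ y * 1 + 0
  lemma = solve-∀
tangent (suc k) x y = +-cancelˡ-≤ common _ _ (begin
  common + suc (suc k) * (y * (x * X))
    ≡⟨ eq₁ k x y X ⟩
  y * (suc k * (y * X)) + suc k * X * (2 * (x * y))
    ≤⟨ +-mono-≤ (*-monoʳ-≤ y (tangent k x y)) (*-monoʳ-≤ (suc k * X) (2xy≤x²+y² x y)) ⟩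
  y * (Y + k * (x * X)) + suc k * X * (x * x + y * y)
    ≡⟨ eq₂ k x y X Y ⟩
  common + (y * Y + suc k * (x * (x * X))) ∎)
  where
  open ≤-Reasoning
  X = x ^ k
  Y = y ^ suc k
  common = suc k * (y * y * X) + k * (x * y * X)
  eq₁ : ∀ k x y X → (1 + k) * (y * y * X) + k * (x * y * X) + (2 + k) * (y * (x * X))
                    ≡ y * ((1 + k) * (y * X)) + (1 + k) * X * (2 * (x * y))
  eq₁ = solve-∀
  eq₂ : ∀ k x y X Y → y * (Y + k * (x * X)) + (1 + k) * X * (x * x + y * y)
                      ≡ (1 + k) * (y * y * X) + k * (x * y * X) + (y * Y + (1 + k) * (x * (x * X)))
  eq₂ = solve-∀

-- The tangent inequality at y/x = ((S + a)/(h + 1)) / (S/h).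
am-gm-step : ∀ h .{{_ : NonZero h}} S a → suc h ^ suc h * (S ^ h * a) ≤ h ^ h * (a + S) ^ suc h
am-gm-step h S a = *-cancelˡ-≤ h (+-cancelʳ-≤ (h * x ^ suc h) _ _ (begin
  h * (suc h * H * (Sₕ * a)) + h * (x * x ^ h)
    ≡⟨ cong (λ t → h * (suc h * H * (Sₕ * a)) + h * (x * t)) (^-distribʳ-* h (suc h) S) ⟩
  h * (suc h * H * (Sₕ * a)) + h * (suc h * S * (H * Sₕ))
    ≡⟨ eq h S a H Sₕ ⟩
  suc h * (y * (H * Sₕ))
    ≡⟨ cong (λ t → suc h * (y * t)) (^-distribʳ-* h (suc h) S) ⟨
  suc h * (y * x ^ h)
    ≤⟨ tangent h x y ⟩
  y ^ suc h + h * x ^ suc h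
    ≡⟨ cong (_+ h * x ^ suc h) (trans (^-distribʳ-* (suc h) h (a + S)) (*-assoc h (h ^ h) _)) ⟩
  h * (h ^ h * (a + S) ^ suc h) + h * x ^ suc h ∎))
  where
  open ≤-Reasoning
  x = suc h * S
  y = h * (a + S)
  H = suc h ^ h
  Sₕ = S ^ h
  eq : ∀ h S a H T → h * ((1 + h) * H * (T * a)) + h * ((1 + h) * S * (H * T))
                     ≡ (1 + h) * (h * (a + S) * (H * T))
  eq = solve-∀

am-gm : ∀ as → product as * length as ^ length as ≤ sum as ^ length as
am-gm [] = ≤-refl
-- A separate case because `am-gm-step` needs a nonempty tail.
am-gm (a ∷ []) = ≤-reflexive (lemma a)
  where
  lemma : ∀ a → a * 1 * 1 ≡ (a + 0) * 1
  lemma = solve-∀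
am-gm (a ∷ as@(_ ∷ _)) = *-cancelˡ-≤ (h ^ h) {{m^n≢0 h h}} (begin
  h ^ h * (a * P * suc h ^ suc h)
    ≡⟨ eq₁ (h ^ h) a P (suc h ^ suc h) ⟩
  P * h ^ h * (a * suc h ^ suc h)
    ≤⟨ *-monoˡ-≤ (a * suc h ^ suc h) (am-gm as) ⟩
  S ^ h * (a * suc h ^ suc h)
    ≡⟨ eq₂ (S ^ h) a (suc h ^ suc h) ⟩
  suc h ^ suc h * (S ^ h * a)
    ≤⟨ am-gm-step h S a ⟩
  h ^ h * (a + S) ^ suc h ∎)
  where
  open ≤-Reasoning
  h = length as
  P = product as
  S = sum as
  eq₁ : ∀ x a P y → x * (a * P * y) ≡ P * x * (a * y)
  eq₁ = solve-∀
  eq₂ : ∀ s a y → s * (a * y) ≡ y * (s * a)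
  eq₂ = solve-∀

-- Cantor's strategy

does-true⁻ : ∀ {a} {P : Set a} (P? : Dec P) → does P? ≡ true → P
does-true⁻ (yes p) _ = p

bitCount : ∀ {n} → (Fin n → Bool) → ℕ
bitCount {n} S = sum (map (λ j → if S j then 1 else 0) (allFin n))

sum-allFin-suc : ∀ {n} (f : Fin (suc n) → ℕ) →
  sum (map f (allFin (suc n))) ≡ f zero + sum (map (f ∘ suc) (allFin n))
sum-allFin-suc f = cong (f zero +_) (cong sum
  (trans (map-tabulate suc f) (sym (map-tabulate id (f ∘ suc)))))

sum-allFin-≤ : ∀ m (f : Fin m → ℕ) k → (∀ i → f i ≤ k) → sum (map f (allFin m)) ≤ m * k
sum-allFin-≤ zero    f k f≤k = z≤n
sum-allFin-≤ (suc m) f k f≤k rewrite sum-allFin-suc f =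
  +-mono-≤ (f≤k zero) (sum-allFin-≤ m (f ∘ suc) k (f≤k ∘ suc))

sum-allFin-≥ : ∀ m (f : Fin m → ℕ) → (∀ i → 1 ≤ f i) → m ≤ sum (map f (allFin m))
sum-allFin-≥ zero    f 1≤f = z≤n
sum-allFin-≥ (suc m) f 1≤f rewrite sum-allFin-suc f =
  +-mono-≤ (1≤f zero) (sum-allFin-≥ m (f ∘ suc) (1≤f ∘ suc))

bitCount-interval : ∀ n (S : Fin n → Bool) a k →
  (∀ j → S j ≡ true → a ≤ toℕ j × toℕ j < a + k) → bitCount S ≤ k
bitCount-interval zero    S a k range = z≤n
bitCount-interval (suc n) S a k range
  rewrite sum-allFin-suc (λ j → if S j then 1 else 0)
  with a | k | S zero in S₀
... | suc a | k     | true  = contradiction (proj₁ (range zero S₀)) λ ()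
... | suc a | k     | false = bitCount-interval n (S ∘ suc) a k λ j Sj →
  let lo , hi = range (suc j) Sj in s≤s⁻¹ lo , s≤s⁻¹ hi
... | zero  | zero  | true  = contradiction (proj₂ (range zero S₀)) λ ()
... | zero  | zero  | false = bitCount-interval n (S ∘ suc) 0 0 λ j Sj →
  contradiction (proj₂ (range (suc j) Sj)) λ ()
... | zero  | suc k | true  = s≤s (bitCount-interval n (S ∘ suc) 0 k λ j Sj →
  z≤n , s≤s⁻¹ (proj₂ (range (suc j) Sj)))
... | zero  | suc k | false = m≤n⇒m≤1+n (bitCount-interval n (S ∘ suc) 0 k λ j Sj →
  z≤n , s≤s⁻¹ (proj₂ (range (suc j) Sj)))

Solvable-mono : ∀ {n m p q} → p ≤ q → Solvable n m p → Solvable n m q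
Solvable-mono p≤q (Q , size≤p , strategy) = Q , ≤-trans size≤p p≤q , strategy

tailsAfter : ∀ {k} → Bool → List (Vec Bool (suc k)) → List (Vec Bool k)
tailsAfter b [] = []
tailsAfter b ((c ∷ x) ∷ xs) with b ≟ᵇ c
... | yes _ = x ∷ tailsAfter b xs
... | no  _ = tailsAfter b xs

tailsAfter-length : ∀ {k} (xs : List (Vec Bool (suc k))) →
  length (tailsAfter false xs) + length (tailsAfter true xs) ≡ length xs
tailsAfter-length [] = refl
tailsAfter-length ((false ∷ x) ∷ xs) = cong suc (tailsAfter-length xs)
tailsAfter-length ((true  ∷ x) ∷ xs) = trans (+-suc _ _) (cong suc (tailsAfter-length xs))

∈-tailsAfter : ∀ {k} b {x : Vec Bool k} {xs} → (b ∷ x) ∈ xs → x ∈ tailsAfter b xs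
∈-tailsAfter b (here refl) with b ≟ᵇ b
... | yes _  = here refl
... | no b≢b = contradiction refl b≢b
∈-tailsAfter b {xs = (c ∷ _) ∷ _} (there x∈xs) with b ≟ᵇ c
... | yes _ = there (∈-tailsAfter b x∈xs)
... | no  _ = ∈-tailsAfter b x∈xs

abstract
  avoid : ∀ {k} → List (Vec Bool k) → Vec Bool k
  avoid {zero}  xs = []
  avoid {suc k} xs with length (tailsAfter false xs) <? 2 ^ k
  ... | yes _ = false ∷ avoid (tailsAfter false xs)
  ... | no  _ = true  ∷ avoid (tailsAfter true xs)

  -- Fewer than 2^(k+1) vectors cannot occupy both halves with 2^k vectors each, and `avoid`
  -- descends into a half that has fewer. It is a function of the list, so the output built from it
  -- depends on the answers alone.
  avoid∉ : ∀ {k} (xs : List (Vec Bool k)) → length xs < 2 ^ k → avoid xs ∉ xs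
  avoid∉ {zero}  []       _ ()
  avoid∉ {zero}  (x ∷ xs) (s≤s ()) _
  avoid∉ {suc k} xs xs<2^ with length (tailsAfter false xs) <? 2 ^ k
  ... | yes F<2^ = avoid∉ (tailsAfter false xs) F<2^ ∘ ∈-tailsAfter false
  ... | no  F≮2^ = avoid∉ (tailsAfter true xs) T<2^ ∘ ∈-tailsAfter true
    where
    T<2^ : length (tailsAfter true xs) < 2 ^ k
    T<2^ = +-cancelˡ-< (2 ^ k) _ _ (begin-strict
      2 ^ k + length (tailsAfter true xs)
        ≤⟨ +-monoˡ-≤ _ (≮⇒≥ F≮2^) ⟩
      length (tailsAfter false xs) + length (tailsAfter true xs)
        ≡⟨ tailsAfter-length xs ⟩
      length xs
        <⟨ xs<2^ ⟩
      2 ^ k + (2 ^ k + 0)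
        ≡⟨ cong (2 ^ k +_) (+-identityʳ (2 ^ k)) ⟩
      2 ^ k + 2 ^ k ∎)
      where open ≤-Reasoning

[a*b+c]/b≡a : ∀ a b c .{{_ : NonZero b}} → c < b → (a * b + c) / b ≡ a
[a*b+c]/b≡a a b c c<b = begin
  (a * b + c) / b     ≡⟨ +-distrib-/-∣ˡ c (n∣m*n a) ⟩
  a * b / b + c / b   ≡⟨ cong₂ _+_ (m*n/n≡m a b) (m<n⇒m/n≡0 c<b) ⟩
  a + 0               ≡⟨ +-identityʳ a ⟩
  a ∎
  where open ≡-Reasoning

[a*b+c]%b≡c : ∀ a b c .{{_ : NonZero b}} → c < b → (a * b + c) % b ≡ c
[a*b+c]%b≡c a b c c<b =
  trans (cong (_% b) (+-comm (a * b) c)) (trans ([m+kn]%n≡m%n c a b) (m<n⇒m%n≡m c<b))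

a≡[a/b]*b+a%b : ∀ a b .{{_ : NonZero b}} → a ≡ a / b * b + a % b
a≡[a/b]*b+a%b a b = trans (m≡m%n+[m/n]*n a b) (+-comm (a % b) _)

-- Extended by `false` to all indices because the last group of rows may run past row m; this only
-- adds harmless patterns to avoid.
bit : ∀ {m n} → Lists m n → ℕ → ℕ → Bool
bit {m} {n} v i j with i <? m | j <? n
... | yes i<m | yes j<n = v (fromℕ< i<m) (fromℕ< j<n)
... | _       | _       = false

bit-toℕ : ∀ {m n} (v : Lists m n) i j → bit v (toℕ i) (toℕ j) ≡ v i j
bit-toℕ {m} {n} v i j with toℕ i <? m | toℕ j <? n
... | yes p | yes q = cong₂ v (fromℕ<-toℕ i p) (fromℕ<-toℕ j q)
... | yes _ | no ¬q = contradiction (toℕ<n j) ¬q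
... | no ¬p | _     = contradiction (toℕ<n i) ¬p

module Blocks (n m k N-1 q : ℕ) (N<2^K : suc N-1 < 2 ^ suc k)
              (qK≤n : q * suc k ≤ n) (m≤qN : m ≤ q * suc N-1) where

  K N : ℕ
  K = suc k
  N = suc N-1

  queries : QuerySet m n
  queries i j = does (toℕ i / N ≟ toℕ j / K)

  pattern-of : Lists m n → ℕ → ℕ → Vec Bool K
  pattern-of v β i = Vec.tabulate λ o → bit v i (β * K + toℕ o)

  patterns : Lists m n → ℕ → List (Vec Bool K)
  patterns v β = tabulate {n = N} λ s → pattern-of v β (β * N + toℕ s)

  -- Columns beyond the q blocks get whatever the same formula yields: beating row i uses only block
  -- `toℕ i / N`, which is among the q blocks.
  output : Lists m n → Fin n → Bool
  output v j = Vec.lookup (avoid (patterns v (toℕ j / K))) (toℕ j mod K)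

  bit-same : ∀ {v w} → SameAnswers queries v w →
             ∀ i j → i / N ≡ j / K → bit v i j ≡ bit w i j
  bit-same same i j eq with i <? m | j <? n
  ... | no _    | _       = refl
  ... | yes _   | no _    = refl
  ... | yes i<m | yes j<n = same _ _ (dec-true (toℕ (fromℕ< i<m) / N ≟ toℕ (fromℕ< j<n) / K)
    (trans (cong (_/ N) (toℕ-fromℕ< i<m)) (trans eq (sym (cong (_/ K) (toℕ-fromℕ< j<n))))))

  output-same : DependsOnlyOnAnswers queries output
  output-same v w same j =
    cong (λ ps → Vec.lookup (avoid ps) (toℕ j mod K)) (tabulate-cong {n = N} λ s → vtabulate-cong λ o →
      bit-same same (β * N + toℕ s) (β * K + toℕ o) (trans ([a*b+c]/b≡a β N (toℕ s) (toℕ<n s))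
                               (sym ([a*b+c]/b≡a β K (toℕ o) (toℕ<n o)))))
    where β = toℕ j / K

  output-wins : AlwaysWins output
  output-wins v i out≡vᵢ = avoid∉ (patterns v β)
    (subst (_< 2 ^ K) 
      (sym (length-tabulate {n = N} λ s → pattern-of v β (β * N + toℕ s))) N<2^K)
    (subst (_∈ patterns v β) (sym avoid≡) pattern∈)
    where
    β = toℕ i / N
    s = toℕ i mod N

    i≡ : β * N + toℕ s ≡ toℕ i
    i≡ = trans (cong (β * N +_) (toℕ-fromℕ< (m%n<n (toℕ i) N))) (sym (a≡[a/b]*b+a%b (toℕ i) N))

    pattern∈ : pattern-of v β (toℕ i) ∈ patterns v β
    pattern∈ = subst (λ x → pattern-of v β x ∈ patterns v β) i≡ 
      (∈-tabulate⁺ {f = λ s → pattern-of v β (β * N + toℕ s)} s)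

    β<q : β < q
    β<q = m<n*o⇒m/o<n (<-≤-trans (toℕ<n i) m≤qN)

    column< : ∀ (o : Fin K) → β * K + toℕ o < n
    column< o = begin-strict
      β * K + toℕ o <⟨ +-monoʳ-< (β * K) (toℕ<n o) ⟩
      β * K + K     ≡⟨ +-comm (β * K) K ⟩
      suc β * K     ≤⟨ *-monoˡ-≤ K β<q ⟩
      q * K         ≤⟨ qK≤n ⟩
      n             ∎
      where open ≤-Reasoning

    module Column (o : Fin K) (j : Fin n) (j≡ : toℕ j ≡ β * K + toℕ o) where
      j/K≡β : toℕ j / K ≡ β
      j/K≡β = trans (cong (_/ K) j≡) ([a*b+c]/b≡a β K (toℕ o) (toℕ<n o))

      jmodK≡o : toℕ j mod K ≡ o
      jmodK≡o = toℕ-injective (trans (toℕ-fromℕ< (m%n<n (toℕ j) K))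
        (trans (cong (_% K) j≡) ([a*b+c]%b≡c β K (toℕ o) (toℕ<n o))))

      lookup-column : Vec.lookup (avoid (patterns v β)) o ≡ bit v (toℕ i) (β * K + toℕ o)
      lookup-column = begin
        Vec.lookup (avoid (patterns v β)) o
          ≡⟨ cong₂ (λ b → Vec.lookup (avoid (patterns v b))) j/K≡β jmodK≡o ⟨
        output v j
          ≡⟨ out≡vᵢ j ⟩
        v i j
          ≡⟨ bit-toℕ v i j ⟨
        bit v (toℕ i) (toℕ j)
          ≡⟨ cong (bit v (toℕ i)) j≡ ⟩
        bit v (toℕ i) (β * K + toℕ o) ∎
        where open ≡-Reasoning

    lookup≡ : ∀ o → Vec.lookup (avoid (patterns v β)) o ≡ bit v (toℕ i) (β * K + toℕ o)
    lookup≡ o = Column.lookup-column o (fromℕ< (column< o)) (toℕ-fromℕ< (column< o))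

    avoid≡ : avoid (patterns v β) ≡ pattern-of v β (toℕ i)
    avoid≡ = trans (sym (tabulate∘lookup _)) (vtabulate-cong lookup≡)

  queries-size : size queries ≤ m * K
  queries-size = sum-allFin-≤ m _ K λ i → bitCount-interval n (queries i) (toℕ i / N * K) K (range i)
    where
    range : ∀ i j → queries i j ≡ true → toℕ i / N * K ≤ toℕ j × toℕ j < toℕ i / N * K + K
    range i j Qij rewrite does-true⁻ (toℕ i / N ≟ toℕ j / K) Qij =
      subst (toℕ j / K * K ≤_) (sym j≡) (m≤m+n _ _) ,
      subst (_< toℕ j / K * K + K) (sym j≡) (+-monoʳ-< _ (m%n<n (toℕ j) K))
      where
      j≡ : toℕ j ≡ toℕ j / K * K + toℕ j % K
      j≡ = a≡[a/b]*b+a%b (toℕ j) K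

  solvable : Solvable n m (m * K)
  solvable = queries , queries-size , output , output-same , output-wins

private
  2^1+k-1 : ∀ k → ∃ λ N-1 → 2 ^ suc k ≡ suc (suc N-1)
  2^1+k-1 k with 2 ^ k | m^n>0 2 k
  ... | suc x | _ = x + x , cong suc (trans (cong (x +_) (+-identityʳ (suc x))) (+-suc x x))

-- Groups of 2^K - 1 rows are the largest from which a pattern of K bits can always escape.
blocks-solvable : ∀ n m k q → q * suc k ≤ n → m ≤ q * (2 ^ suc k ∸ 1) → Solvable n m (m * suc k)
blocks-solvable n m k q qK≤n m≤ with 2 ^ suc k in eq | 2^1+k-1 k
... | _ | N-1 , refl = Blocks.solvable n m k N-1 q (≤-reflexive (sym eq)) qK≤n m≤

-- Kronecker's strategy

-- Kronecker may change all unqueried bits to those of the output.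
unqueried-hit : ∀ {m n} {Q : QuerySet m n} {out} → DependsOnlyOnAnswers Q out → AlwaysWins out →
  ∀ v i → ¬ (∀ j → Q i j ≡ true → v i j ≡ out v j)
unqueried-hit {m} {n} {Q} {out} depends wins v i agrees =
  wins w i λ j → trans (depends w v w~v j) (out≡w j)
  where
  w : Lists m n
  w i j = if Q i j then v i j else out v j
  w~v : SameAnswers Q w v
  w~v i j Qij rewrite Qij = refl
  out≡w : ∀ j → out v j ≡ w i j
  out≡w j with Q i j in Qij
  ... | true  = sym (agrees j Qij)
  ... | false = refl

bitCount≡0⇒false : ∀ {n} (S : Fin n → Bool) → bitCount S ≡ 0 → ∀ j → S j ≡ false
bitCount≡0⇒false {suc n} S eq j
  with S zero in S₀ | j | trans (sym (sum-allFin-suc (λ j → if S j then 1 else 0))) eq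
... | false | zero  | _   = S₀
... | false | suc j | eq′ = bitCount≡0⇒false (S ∘ suc) eq′ j
... | true  | _     | ()

rows≤queries : ∀ {n m q} → Solvable n m q → m ≤ q
rows≤queries {n} {m} (Q , size≤q , out , depends , wins) =
  ≤-trans (sum-allFin-≥ m (bitCount ∘ Q) row≥1) size≤q
  where
  row≥1 : ∀ i → 1 ≤ bitCount (Q i)
  row≥1 i = n≢0⇒n>0 λ eq → unqueried-hit depends wins (λ _ _ → false) i λ j Qij →
    contradiction (trans (sym Qij) (bitCount≡0⇒false (Q i) eq j)) λ ()

-- Answers that match many points.

Mask : ℕ → Set
Mask n = Fin n → Bool

agree : ∀ {n} → Mask n → (a u : Fin n → Bool) → Bool
agree {zero}  S a u = true
agree {suc n} S a u = (if S zero then does (a zero ≟ᵇ u zero) else true) ∧ agree (S ∘ suc) (a ∘ suc) (u ∘ suc)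

agree-sound : ∀ {n} (S : Mask n) a u → agree S a u ≡ true → ∀ j → S j ≡ true → a j ≡ u j
agree-sound {suc n} S a u ag j Sj with S zero in S₀ | a zero ≟ᵇ u zero
agree-sound S a u ag (suc j) Sj | true | yes _ = agree-sound (S ∘ suc) (a ∘ suc) (u ∘ suc) ag j Sj
agree-sound S a u ag (suc j) Sj | false | _ = agree-sound (S ∘ suc) (a ∘ suc) (u ∘ suc) ag j Sj
agree-sound S a u ag zero Sj | true | yes a≡u = a≡u
agree-sound S a u ag zero Sj | false | _ = contradiction (trans (sym Sj) S₀) λ ()

agree-refl : ∀ {n} (S : Mask n) u → agree S u u ≡ true
agree-refl {zero}  S u = refl
agree-refl {suc n} S u with S zero | u zero ≟ᵇ u zero
... | false | _      = agree-refl (S ∘ suc) (u ∘ suc)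
... | true  | yes _  = agree-refl (S ∘ suc) (u ∘ suc)
... | true  | no u≢u = contradiction refl u≢u

module _ {X : Set} where

  count : (X → Bool) → List X → ℕ
  count p xs = length (filterᵇ p xs)

  count-∧ : ∀ (p q : X → Bool) xs → count (λ x → p x ∧ q x) xs ≡ count q (filterᵇ p xs)
  count-∧ p q [] = refl
  count-∧ p q (x ∷ xs) with p x | q x in qx
  ... | false | _     = count-∧ p q xs
  ... | true  | true  rewrite qx = cong suc (count-∧ p q xs)
  ... | true  | false rewrite qx = count-∧ p q xs

  count-not : ∀ p xs → count p xs + count (not ∘ p) xs ≡ length xs
  count-not p [] = refl
  count-not p (x ∷ xs) with p x
  ... | true  = cong suc (count-not p xs)
  ... | false = trans (+-suc _ _) (cong suc (count-not p xs))

  count-bits : ∀ (f : X → Bool) xs →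
    count (λ x → does (false ≟ᵇ f x)) xs + count (λ x → does (true ≟ᵇ f x)) xs ≡ length xs
  count-bits f [] = refl
  count-bits f (x ∷ xs) with f x
  ... | false = cong suc (count-bits f xs)
  ... | true  = trans (+-suc _ _) (cong suc (count-bits f xs))

  majority-bit : ∀ (f : X → Bool) xs → ∃ λ b → length xs ≤ 2 * count (λ x → does (b ≟ᵇ f x)) xs
  majority-bit f xs with ≤-total (count (λ x → does (false ≟ᵇ f x)) xs) (count (λ x → does (true ≟ᵇ f x)) xs)
  ... | inj₁ F≤T = true , (begin
    length xs                                    ≡⟨ count-bits f xs ⟨
    count (λ x → does (false ≟ᵇ f x)) xs + t     ≤⟨ +-monoˡ-≤ t F≤T ⟩
    t + t                                        ≡⟨ cong (t +_) (+-identityʳ t) ⟨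
    2 * t                                        ∎)
    where
    open ≤-Reasoning
    t = count (λ x → does (true ≟ᵇ f x)) xs
  ... | inj₂ T≤F = false , (begin
    length xs                                    ≡⟨ count-bits f xs ⟨
    t + count (λ x → does (true ≟ᵇ f x)) xs      ≤⟨ +-monoʳ-≤ t T≤F ⟩
    t + t                                        ≡⟨ cong (t +_) (+-identityʳ t) ⟨
    2 * t                                        ∎)
    where
    open ≤-Reasoning
    t = count (λ x → does (false ≟ᵇ f x)) xs

  -- The answers are fixed column by column: the majority value of a queried bit keeps at least half
  -- of the points still in agreement.
  majority : ∀ {n} (S : Mask n) (bits : X → Fin n → Bool) xs →
    ∃ λ a → length xs ≤ 2 ^ bitCount S * count (λ x → agree S a (bits x)) xs
  majority {zero} S bits xs = (λ ()) , ≤-reflexive (trans (all xs) (sym (+-identityʳ _)))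
    where
    all : ∀ xs → length xs ≡ count (λ _ → true) xs
    all [] = refl
    all (x ∷ xs) = cong suc (all xs)
  majority {suc n} S bits xs rewrite sum-allFin-suc (λ j → if S j then 1 else 0) with S zero
  -- The answer in an unqueried column is arbitrary.
  ... | false = let a , le = majority (S ∘ suc) (λ x → bits x ∘ suc) xs in (false VecF.∷ a) , le
  ... | true  = (b VecF.∷ a) , (begin
    length xs
      ≤⟨ le₁ ⟩
    2 * count p xs
      ≤⟨ *-monoʳ-≤ 2 le₂ ⟩
    2 * (2 ^ d * count q (filterᵇ p xs))
      ≡⟨ *-assoc 2 (2 ^ d) _ ⟨
    2 ^ suc d * count q (filterᵇ p xs)
      ≡⟨ cong (2 ^ suc d *_) (count-∧ p q xs) ⟨
    2 ^ suc d * count (λ x → p x ∧ q x) xs ∎)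
    where
    open ≤-Reasoning
    d = bitCount (S ∘ suc)
    maj = majority-bit (λ x → bits x zero) xs
    b = proj₁ maj
    le₁ = proj₂ maj
    p : X → Bool
    p x = does (b ≟ᵇ bits x zero)
    rest = majority (S ∘ suc) (λ x → bits x ∘ suc) (filterᵇ p xs)
    a = proj₁ rest
    le₂ = proj₂ rest
    q : X → Bool
    q x = agree (S ∘ suc) a (bits x ∘ suc)

-- The unqueried bits of a row with queries S and answers a can be completed so that the row equals
-- u; then u is not a safe output.
Hits : ∀ {n} → Vec Bool n → Mask n × (Fin n → Bool) → Set
Hits u (S , a) = agree S a (Vec.lookup u) ≡ true

-- The fraction 2^(-d) scaled by 2^n, which is the number of points that a row with d queries
-- matches.
weight : ∀ {n} → Mask n → ℕ
weight {n} S = 2 ^ (n ∸ bitCount S)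

bitCount≤n : ∀ {n} (S : Mask n) → bitCount S ≤ n
bitCount≤n {n} S = subst (bitCount S ≤_) (*-identityʳ n) (sum-allFin-≤ n _ 1 ≤1)
  where
  ≤1 : ∀ j → (if S j then 1 else 0) ≤ 1
  ≤1 j with S j
  ... | true  = ≤-refl
  ... | false = z≤n

2^bitCount*weight : ∀ {n} (S : Mask n) → 2 ^ bitCount S * weight S ≡ 2 ^ n
2^bitCount*weight {n} S = trans (sym (^-distribˡ-+-* 2 (bitCount S) _)) (cong (2 ^_) (m+[n∸m]≡n (bitCount≤n S)))

-- By `majority` the unmatched points shrink at least by the factor 1 - 1/D, and D such factors
-- amount to at most 1/2 by `shrink-halves`. The exponent 2^n = D * w does not depend on the row, so
-- the estimates of successive rows multiply.
greedy-row : ∀ {n} (S : Mask n) (P : List (Vec Bool n)) → ∃₂ λ a P′ →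
  (∀ {u} → u ∈ P → u ∈ P′ ⊎ Hits u (S , a)) ×
  length P′ ^ 2 ^ n * 2 ^ weight S ≤ length P ^ 2 ^ n
greedy-row {n} S P = a , P′ , split , (begin
  y ^ 2 ^ n * 2 ^ w         ≡⟨ cong (λ t → y ^ t * 2 ^ w) (2^bitCount*weight S) ⟨
  y ^ (D * w) * 2 ^ w       ≡⟨ cong (_* 2 ^ w) (^-*-assoc y D w) ⟨
  (y ^ D) ^ w * 2 ^ w       ≡⟨ ^-distribʳ-* w (y ^ D) 2 ⟨
  (y ^ D * 2) ^ w           ≡⟨ cong (_^ w) (*-comm (y ^ D) 2) ⟩
  (2 * y ^ D) ^ w           ≤⟨ ^-monoˡ-≤ w (shrink-halves D {{m^n≢0 2 (bitCount S)}} le) ⟩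
  (x ^ D) ^ w               ≡⟨ ^-*-assoc x D w ⟩
  x ^ (D * w)               ≡⟨ cong (x ^_) (2^bitCount*weight S) ⟩
  x ^ 2 ^ n                 ∎)
  where
  open ≤-Reasoning
  maj = majority S Vec.lookup P
  a = proj₁ maj
  hit : Vec Bool n → Bool
  hit u = agree S a (Vec.lookup u)
  P′ = filterᵇ (not ∘ hit) P
  D = 2 ^ bitCount S
  w = weight S
  x = length P
  y = length P′
  split : ∀ {u} → u ∈ P → u ∈ P′ ⊎ Hits u (S , a)
  split {u} u∈P with hit u in eq
  ... | true  = inj₂ refl
  ... | false = inj₁ (∈-filter⁺ (T? ∘ not ∘ hit) u∈P (subst (T ∘ not) (sym eq) tt))
  le : x + D * y ≤ D * x
  le = begin
    x + D * y                   ≤⟨ +-monoˡ-≤ (D * y) (proj₂ maj) ⟩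
    D * count hit P + D * y     ≡⟨ *-distribˡ-+ D _ y ⟨
    D * (count hit P + y)       ≡⟨ cong (D *_) (count-not hit P) ⟩
    D * x                       ∎

greedy : ∀ {n} (Ss : List (Mask n)) (P : List (Vec Bool n)) → ∃₂ λ ps P′ →
  map proj₁ ps ≡ Ss ×
  (∀ {u} → u ∈ P → u ∈ P′ ⊎ Any (Hits u) ps) ×
  length P′ ^ 2 ^ n * 2 ^ sum (map weight Ss) ≤ length P ^ 2 ^ n
greedy [] P = [] , P , refl , inj₁ , ≤-reflexive (*-identityʳ _)
greedy {n} (S ∷ Ss) P
  with a  , P₁ , split₁ , le₁ ← greedy-row S P
  with ps , P₂ , eq , split₂ , le₂ ← greedy Ss P₁
  = (S , a) ∷ ps , P₂ , cong (S ∷_) eq , split , (begin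
  length P₂ ^ M * 2 ^ (weight S + W)       ≡⟨ cong (length P₂ ^ M *_)
                                                  (trans (^-distribˡ-+-* 2 (weight S) W) (*-comm (2 ^ weight S) (2 ^ W))) ⟩
  length P₂ ^ M * (2 ^ W * 2 ^ weight S)   ≡⟨ *-assoc (length P₂ ^ M) (2 ^ W) (2 ^ weight S) ⟨
  length P₂ ^ M * 2 ^ W * 2 ^ weight S     ≤⟨ *-monoˡ-≤ (2 ^ weight S) le₂ ⟩
  length P₁ ^ M * 2 ^ weight S             ≤⟨ le₁ ⟩
  length P ^ M                             ∎)
  where
  open ≤-Reasoning
  M = 2 ^ n
  W = sum (map weight Ss)
  split : ∀ {u} → u ∈ P → u ∈ P₂ ⊎ Any (Hits u) ((S , a) ∷ ps)
  split u∈P with split₁ u∈P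
  ... | inj₂ hit = inj₂ (here hit)
  ... | inj₁ u∈P₁ with split₂ u∈P₁
  ...   | inj₁ u∈P₂ = inj₁ u∈P₂
  ...   | inj₂ hit  = inj₂ (there hit)

-- Each row answers as if it were one of the points; rows left over answer arbitrarily.
hit-each : ∀ {n} (Ss : List (Mask n)) (P : List (Vec Bool n)) → length P ≤ length Ss →
  ∃ λ ps → map proj₁ ps ≡ Ss × (∀ {u} → u ∈ P → Any (Hits u) ps)
hit-each []       []      _  = [] , refl , λ ()
hit-each (S ∷ Ss) []      _  =
  let ps , eq , _ = hit-each Ss [] z≤n in (S , λ _ → false) ∷ ps , cong (S ∷_) eq , λ ()
hit-each (S ∷ Ss) (p ∷ P) le =
  let ps , eq , hits = hit-each Ss P (s≤s⁻¹ le) in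
  (S , Vec.lookup p) ∷ ps , cong (S ∷_) eq ,
  λ { (here refl) → here (agree-refl S (Vec.lookup p)) ; (there u∈P) → there (hits u∈P) }

allVecs : ∀ n → List (Vec Bool n)
allVecs zero    = [] ∷ []
allVecs (suc n) = map (false ∷_) (allVecs n) ++ map (true ∷_) (allVecs n)

length-allVecs : ∀ n → length (allVecs n) ≡ 2 ^ n
length-allVecs zero    = refl
length-allVecs (suc n) = begin
  length (map (false ∷_) (allVecs n) ++ map (true ∷_) (allVecs n))
    ≡⟨ length-++ (map (false ∷_) (allVecs n)) ⟩
  length (map (false ∷_) (allVecs n)) + length (map (true ∷_) (allVecs n))
    ≡⟨ cong₂ _+_ (length-map _ (allVecs n)) (length-map _ (allVecs n)) ⟩
  length (allVecs n) + length (allVecs n)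
    ≡⟨ cong₂ _+_ (length-allVecs n) (trans (length-allVecs n) (sym (+-identityʳ _))) ⟩
  2 ^ suc n ∎
  where open ≡-Reasoning

∈-allVecs : ∀ {n} (u : Vec Bool n) → u ∈ allVecs n
∈-allVecs []          = here refl
∈-allVecs (false ∷ u) = ∈-++⁺ˡ (∈-map⁺ (false ∷_) (∈-allVecs u))
∈-allVecs (true  ∷ u) = ∈-++⁺ʳ _ (∈-map⁺ (true ∷_) (∈-allVecs u))

tabulate≡map-proj₁ : ∀ {A B : Set} {m} (f : Fin m → A) (cs : List (A × B)) →
  tabulate f ≡ map proj₁ cs → ∃ λ (g : Fin m → B) → cs ≡ tabulate (λ i → f i , g i)
tabulate≡map-proj₁ {m = zero}  f []             _    = (λ ()) , refl
tabulate≡map-proj₁ {m = suc m} f ((_ , b) ∷ cs) eq with refl , eq′ ← ∷-injective eq =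
  let g , eq″ = tabulate≡map-proj₁ (f ∘ suc) cs eq′ in (b VecF.∷ g) , cong ((_ , b) ∷_) eq″

-- The point to examine is the output itself: a row that hits it contradicts `unqueried-hit`. The
-- rows come in any order because the greedy ones are selected by their number of queries.
no-cover : ∀ {m n} {Q : QuerySet m n} {out} → DependsOnlyOnAnswers Q out → AlwaysWins out →
  ∀ ps → map proj₁ ps ↭ tabulate Q → ¬ (∀ u → Any (Hits u) ps)
no-cover {Q = Q} {out} depends wins ps ps↭Q cover
  with cs , eq , ps↭cs ← ↭-map-inv proj₁ ps↭Q
  with v , refl ← tabulate≡map-proj₁ Q cs eq
  with i , hit ← tabulate⁻ (Any-resp-↭ ps↭cs (cover (Vec.tabulate (out v))))
  = unqueried-hit depends wins v i λ j Qij →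
      trans (agree-sound (Q i) (v i) _ hit j Qij) (lookup∘tabulate (out v) j)

-- Selecting the rows with the fewest queries.

module _ {A : Set} (f : A → ℕ) where

  extract-max : ∀ x xs → ∃₂ λ y ys → (x ∷ xs) ↭ (y ∷ ys) × All (λ z → f z ≤ f y) ys
  extract-max x [] = x , [] , ↭-refl , []
  extract-max x (x′ ∷ xs) with y , ys , σ , ≤y ← extract-max x′ xs with ≤-total (f x) (f y)
  ... | inj₁ x≤y = y , x ∷ ys , ↭-trans (prep x σ) (swap x y ↭-refl) , x≤y ∷ ≤y
  ... | inj₂ y≤x = x , y ∷ ys , prep x σ , y≤x ∷ All.map (λ z≤y → ≤-trans z≤y y≤x) ≤y

  sum-map-≤ : ∀ {b} xs → All (λ z → f z ≤ b) xs → sum (map f xs) ≤ length xs * b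
  sum-map-≤ []       []         = z≤n
  sum-map-≤ (x ∷ xs) (x≤b ∷ ≤b) = +-mono-≤ x≤b (sum-map-≤ xs ≤b)

  -- A maximal element is discarded k times, and no such removal raises the average of what remains.
  lightest : ∀ h k xs → length xs ≡ h + k → ∃₂ λ ys zs → xs ↭ ys ++ zs ×
    length ys ≡ h × length zs ≡ k × (h + k) * sum (map f ys) ≤ h * sum (map f xs)
  lightest h zero xs len =
    xs , [] , ↭-reflexive (sym (++-identityʳ xs)) , trans len (+-identityʳ h) , refl ,
    ≤-reflexive (cong (_* sum (map f xs)) (+-identityʳ h))
  lightest h (suc k) [] len with () ← trans len (+-suc h k)
  lightest h (suc k) (x ∷ xs) len
    with w , ws , σ , ≤w ← extract-max x xs
    with ys , zs , τ , leny , lenz , le ← lightest h k ws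
      (suc-injective (trans (sym (↭-length σ)) (trans len (+-suc h k))))
    = ys , w ∷ zs , ↭-trans σ (↭-trans (prep w τ) (↭-sym (shift w ys zs))) , leny , cong suc lenz , (begin
    (h + suc k) * Y         ≡⟨ cong (_* Y) (+-suc h k) ⟩
    Y + (h + k) * Y         ≤⟨ +-mono-≤ Y≤ le ⟩
    h * f w + h * sum (map f ws)   ≡⟨ *-distribˡ-+ h (f w) _ ⟨
    h * sum (map f (w ∷ ws))       ≡⟨ cong (h *_) (sum-↭ (map⁺ f σ)) ⟨
    h * sum (map f (x ∷ xs))       ∎)
    where
    open ≤-Reasoning
    Y = sum (map f ys)
    Y≤ : Y ≤ h * f w
    Y≤ = subst (λ l → Y ≤ l * f w) leny (sum-map-≤ ys (++⁻ˡ ys (All-resp-↭ τ ≤w)))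

product-weights : ∀ {n} (Ss : List (Mask n)) →
  product (map weight Ss) * 2 ^ sum (map bitCount Ss) ≡ (2 ^ n) ^ length Ss
product-weights [] = refl
product-weights {n} (S ∷ Ss) = begin
  weight S * Π * 2 ^ (bitCount S + E)
    ≡⟨ cong (weight S * Π *_) (^-distribˡ-+-* 2 (bitCount S) E) ⟩
  weight S * Π * (2 ^ bitCount S * 2 ^ E)
    ≡⟨ eq (weight S) Π (2 ^ bitCount S) (2 ^ E) ⟩
  2 ^ bitCount S * weight S * (Π * 2 ^ E)
    ≡⟨ cong₂ _*_ (2^bitCount*weight S) (product-weights Ss) ⟩
  2 ^ n * (2 ^ n) ^ length Ss ∎
  where
  open ≡-Reasoning
  Π = product (map weight Ss)
  E = sum (map bitCount Ss)
  eq : ∀ w p b e → w * p * (b * e) ≡ b * w * (p * e)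
  eq = solve-∀

-- A / 2 ^ n is the sum of 2 ^ (- d) over the lighter half of the rows, a row with d queries
-- being matched by a fraction 2 ^ (- d) of the points.
lower-core : ∀ {n m q} → 1 ≤ m → Solvable n m q → ∃ λ A →
  m ^ 2 ^ n * 2 ^ A ≤ (2 * 2 ^ n) ^ 2 ^ n × (2 ^ n * m) ^ m ≤ A ^ m * 2 ^ (q + m)
lower-core {n} {m} {q} 1≤m (Q , size≤q , out , depends , wins)
  with xs , ys , σ , lenx , leny , lights ← lightest bitCount ⌈ m /2⌉ ⌊ m /2⌋ (tabulate Q)
    (trans (length-tabulate Q) (sym (trans (+-comm ⌈ m /2⌉ _) (⌊n/2⌋+⌈n/2⌉≡n m))))
  with ps , P , eqp , splitp , lep ← greedy xs (allVecs n)
  = A , covering , averaging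
  where
  open ≤-Reasoning
  M = 2 ^ n
  h = ⌈ m /2⌉
  k = ⌊ m /2⌋
  A = sum (map weight xs)
  E = sum (map bitCount xs)

  h+k≡m : h + k ≡ m
  h+k≡m = trans (+-comm h k) (⌊n/2⌋+⌈n/2⌉≡n m)

  -- Otherwise each spared row could take over one surviving point, and all points would be matched.
  k<P : k < length P
  k<P = ≰⇒> λ P≤k →
    let qs , eqq , hits = hit-each ys P (subst (length P ≤_) (sym leny) P≤k) in
    no-cover depends wins (ps ++ qs)
      (↭-trans (↭-reflexive (trans (map-++ proj₁ ps qs) (cong₂ _++_ eqp eqq))) (↭-sym σ))
      λ u → cover qs hits (splitp (∈-allVecs u))
    where
    cover : ∀ {u} qs → (∀ {u} → u ∈ P → Any (Hits u) qs) → u ∈ P ⊎ Any (Hits u) ps → Any (Hits u) (ps ++ qs)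
    cover qs hits (inj₁ u∈P) = ++⁺ʳ ps (hits u∈P)
    cover qs hits (inj₂ hit) = ++⁺ˡ hit

  h≤1+k : h ≤ suc k
  h≤1+k = ⌈n/2⌉≤1+⌊n/2⌋ m
    where
    ⌈n/2⌉≤1+⌊n/2⌋ : ∀ n → ⌈ n /2⌉ ≤ suc ⌊ n /2⌋
    ⌈n/2⌉≤1+⌊n/2⌋ zero          = z≤n
    ⌈n/2⌉≤1+⌊n/2⌋ (suc zero)    = ≤-refl
    ⌈n/2⌉≤1+⌊n/2⌋ (suc (suc n)) = s≤s (⌈n/2⌉≤1+⌊n/2⌋ n)

  m≤2P : m ≤ 2 * length P
  m≤2P = begin
    m                      ≡⟨ h+k≡m ⟨
    h + k                  ≤⟨ +-mono-≤ (≤-trans h≤1+k k<P) (≤-trans (<⇒≤ k<P) (≤-reflexive (sym (+-identityʳ _)))) ⟩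
    2 * length P           ∎

  -- In logarithms, divided by M: log m + A / M ≤ n + 1.
  covering : m ^ M * 2 ^ A ≤ (2 * M) ^ M
  covering = begin
    m ^ M * 2 ^ A                   ≤⟨ *-monoˡ-≤ (2 ^ A) (^-monoˡ-≤ M m≤2P) ⟩
    (2 * length P) ^ M * 2 ^ A      ≡⟨ cong (_* 2 ^ A) (^-distribʳ-* M 2 (length P)) ⟩
    2 ^ M * length P ^ M * 2 ^ A    ≡⟨ *-assoc (2 ^ M) (length P ^ M) (2 ^ A) ⟩
    2 ^ M * (length P ^ M * 2 ^ A)  ≤⟨ *-monoʳ-≤ (2 ^ M) lep ⟩
    2 ^ M * length (allVecs n) ^ M  ≡⟨ cong (λ l → 2 ^ M * l ^ M) (length-allVecs n) ⟩
    2 ^ M * M ^ M                   ≡⟨ ^-distribʳ-* M 2 M ⟨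
    (2 * M) ^ M                     ∎

  h>0 : 0 < h
  h>0 = ⌈n/2⌉-mono 1≤m

  E*m≤q*h : E * m ≤ q * h
  E*m≤q*h = begin
    E * m                               ≡⟨ trans (*-comm E m) (cong (_* E) (sym h+k≡m)) ⟩
    (h + k) * E                         ≤⟨ lights ⟩
    h * sum (map bitCount (tabulate Q)) ≡⟨ cong (λ l → h * sum l)
                                             (trans (map-tabulate Q bitCount) (sym (map-tabulate id (bitCount ∘ Q)))) ⟩
    h * size Q                          ≤⟨ *-monoʳ-≤ h size≤q ⟩
    h * q                               ≡⟨ *-comm h q ⟩
    q * h                               ∎

  means : (M * h) ^ h ≤ A ^ h * 2 ^ E
  means = begin
    (M * h) ^ h                                      ≡⟨ ^-distribʳ-* h M h ⟩
    M ^ h * h ^ h                                    ≡⟨ cong (λ l → M ^ l * h ^ h) lenx ⟨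
    M ^ length xs * h ^ h                            ≡⟨ cong (_* h ^ h) (product-weights xs) ⟨
    product (map weight xs) * 2 ^ E * h ^ h          ≡⟨ eq (product (map weight xs)) (2 ^ E) (h ^ h) ⟩
    product (map weight xs) * h ^ h * 2 ^ E          ≤⟨ *-monoˡ-≤ (2 ^ E) amgm ⟩
    A ^ h * 2 ^ E                                    ∎
    where
    eq : ∀ p e x → p * e * x ≡ p * x * e
    eq = solve-∀
    amgm : product (map weight xs) * h ^ h ≤ A ^ h
    amgm = subst (λ l → product (map weight xs) * l ^ l ≤ A ^ l)
      (trans (length-map weight xs) lenx) (am-gm (map weight xs))

  -- This is `means` to the power m / h, where E * m / h ≤ q. Both sides are raised to the power h
  -- to keep the exponents integral.
  averaging-half : (M * h) ^ m ≤ A ^ m * 2 ^ q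
  averaging-half = ^-cancelʳ-≤ h {{>-nonZero h>0}} (begin
    ((M * h) ^ m) ^ h           ≡⟨ ^-swap (M * h) m h ⟩
    ((M * h) ^ h) ^ m           ≤⟨ ^-monoˡ-≤ m means ⟩
    (A ^ h * 2 ^ E) ^ m         ≡⟨ ^-distribʳ-* m (A ^ h) (2 ^ E) ⟩
    (A ^ h) ^ m * (2 ^ E) ^ m   ≡⟨ cong₂ _*_ (^-swap A h m) (^-*-assoc 2 E m) ⟩
    (A ^ m) ^ h * 2 ^ (E * m)   ≤⟨ *-monoʳ-≤ ((A ^ m) ^ h) (^-monoʳ-≤ 2 E*m≤q*h) ⟩
    (A ^ m) ^ h * 2 ^ (q * h)   ≡⟨ cong ((A ^ m) ^ h *_) (^-*-assoc 2 q h) ⟨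
    (A ^ m) ^ h * (2 ^ q) ^ h   ≡⟨ ^-distribʳ-* h (A ^ m) (2 ^ q) ⟨
    (A ^ m * 2 ^ q) ^ h         ∎)

  m≤h*2 : m ≤ h * 2
  m≤h*2 = begin
    m       ≡⟨ h+k≡m ⟨
    h + k   ≤⟨ +-monoʳ-≤ h (⌊n/2⌋≤⌈n/2⌉ m) ⟩
    h + h   ≡⟨ trans (*-comm h 2) (cong (h +_) (+-identityʳ h)) ⟨
    h * 2   ∎

  -- Passing from h to m / 2 costs the factor 2^m, the source of the -1 in the lower bound.
  averaging : (M * m) ^ m ≤ A ^ m * 2 ^ (q + m)
  averaging = begin
    (M * m) ^ m               ≤⟨ ^-monoˡ-≤ m (*-monoʳ-≤ M m≤h*2) ⟩
    (M * (h * 2)) ^ m         ≡⟨ cong (_^ m) (*-assoc M h 2) ⟨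
    (M * h * 2) ^ m           ≡⟨ ^-distribʳ-* m (M * h) 2 ⟩
    (M * h) ^ m * 2 ^ m       ≤⟨ *-monoˡ-≤ (2 ^ m) averaging-half ⟩
    A ^ m * 2 ^ q * 2 ^ m     ≡⟨ *-assoc (A ^ m) (2 ^ q) (2 ^ m) ⟩
    A ^ m * (2 ^ q * 2 ^ m)   ≡⟨ cong (A ^ m *_) (^-distribˡ-+-* 2 q m) ⟨
    A ^ m * 2 ^ (q + m)       ∎

-- Rational exponents

fromℚᵘ-* : ∀ p q → fromℚᵘ (p ℚᵘ.* q) ≡ fromℚᵘ p ℚ.* fromℚᵘ q
fromℚᵘ-* p q = ℚ.toℚᵘ-injective (begin
  toℚᵘ (fromℚᵘ (p ℚᵘ.* q))                  ≈⟨ ℚ.toℚᵘ-fromℚᵘ (p ℚᵘ.* q) ⟩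
  p ℚᵘ.* q                                  ≈⟨ ℚᵘ.*-cong (ℚ.toℚᵘ-fromℚᵘ p) (ℚ.toℚᵘ-fromℚᵘ q) ⟨
  toℚᵘ (fromℚᵘ p) ℚᵘ.* toℚᵘ (fromℚᵘ q)      ≈⟨ ℚ.toℚᵘ-homo-* (fromℚᵘ p) (fromℚᵘ q) ⟨
  toℚᵘ (fromℚᵘ p ℚ.* fromℚᵘ q)              ∎)
  where open ℚᵘ.≃-Reasoning

fromℚᵘ-+ : ∀ p q → fromℚᵘ (p ℚᵘ.+ q) ≡ fromℚᵘ p ℚ.+ fromℚᵘ q
fromℚᵘ-+ p q = ℚ.toℚᵘ-injective (begin
  toℚᵘ (fromℚᵘ (p ℚᵘ.+ q))                  ≈⟨ ℚ.toℚᵘ-fromℚᵘ (p ℚᵘ.+ q) ⟩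
  p ℚᵘ.+ q                                  ≈⟨ ℚᵘ.+-cong (ℚ.toℚᵘ-fromℚᵘ p) (ℚ.toℚᵘ-fromℚᵘ q) ⟨
  toℚᵘ (fromℚᵘ p) ℚᵘ.+ toℚᵘ (fromℚᵘ q)      ≈⟨ ℚ.toℚᵘ-homo-+ (fromℚᵘ p) (fromℚᵘ q) ⟨
  toℚᵘ (fromℚᵘ p ℚ.+ fromℚᵘ q)              ∎)
  where open ℚᵘ.≃-Reasoning

nℚ-* : ∀ a b → nℚ (a * b) ≡ nℚ a ℚ.* nℚ b
nℚ-* a b = trans (cong (λ z → fromℚᵘ (mkℚᵘ z 0)) (ℤ.pos-* a b)) (fromℚᵘ-* (mkℚᵘ (ℤ.+ a) 0) (mkℚᵘ (ℤ.+ b) 0))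

nℚ-+ : ∀ a b → nℚ (a + b) ≡ nℚ a ℚ.+ nℚ b
nℚ-+ a b = trans
  (cong (λ z → fromℚᵘ (mkℚᵘ z 0))
    (trans (ℤ.pos-+ a b) (sym (cong₂ ℤ._+_ (ℤ.*-identityʳ (ℤ.+ a)) (ℤ.*-identityʳ (ℤ.+ b))))))
  (fromℚᵘ-+ (mkℚᵘ (ℤ.+ a) 0) (mkℚᵘ (ℤ.+ b) 0))

private
  toℚᵘ-nℚ : ∀ a → toℚᵘ (nℚ a) ℚᵘ.≃ mkℚᵘ (ℤ.+ a) 0
  toℚᵘ-nℚ a = ℚ.toℚᵘ-fromℚᵘ (mkℚᵘ (ℤ.+ a) 0)

nℚ-mono-≤ : ∀ {a b} → a ≤ b → nℚ a ℚ.≤ nℚ b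
nℚ-mono-≤ {a} {b} a≤b = ℚ.toℚᵘ-cancel-≤ (begin
  toℚᵘ (nℚ a)   ≃⟨ toℚᵘ-nℚ a ⟩
  mkℚᵘ (ℤ.+ a) 0  ≤⟨ *≤* (ℤ.*-monoʳ-≤-nonNeg (ℤ.+ 1) (ℤ.+≤+ a≤b)) ⟩
  mkℚᵘ (ℤ.+ b) 0  ≃⟨ toℚᵘ-nℚ b ⟨
  toℚᵘ (nℚ b)   ∎)
  where open ℚᵘ.≤-Reasoning

nℚ-mono-< : ∀ {a b} → a < b → nℚ a ℚ.< nℚ b
nℚ-mono-< {a} {b} a<b = ℚ.toℚᵘ-cancel-< (begin-strict
  toℚᵘ (nℚ a)   ≃⟨ toℚᵘ-nℚ a ⟩
  mkℚᵘ (ℤ.+ a) 0  <⟨ *<* (ℤ.*-monoʳ-<-pos (ℤ.+ 1) (ℤ.+<+ a<b)) ⟩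
  mkℚᵘ (ℤ.+ b) 0  ≃⟨ toℚᵘ-nℚ b ⟨
  toℚᵘ (nℚ b)   ∎)
  where open ℚᵘ.≤-Reasoning

nℚ-cancel-≤ : ∀ {a b} → nℚ a ℚ.≤ nℚ b → a ≤ b
nℚ-cancel-≤ le = ≮⇒≥ λ b<a → ℚ.<-irrefl refl (ℚ.<-≤-trans (nℚ-mono-< b<a) le)

nℚ-cancel-< : ∀ {a b} → nℚ a ℚ.< nℚ b → a < b
nℚ-cancel-< lt = ≰⇒> λ b≤a → ℚ.<-irrefl refl (ℚ.<-≤-trans lt (nℚ-mono-≤ b≤a))

nℚ-injective : ∀ {a b} → nℚ a ≡ nℚ b → a ≡ b
nℚ-injective eq = ≤-antisym (nℚ-cancel-≤ (ℚ.≤-reflexive eq)) (nℚ-cancel-≤ (ℚ.≤-reflexive (sym eq)))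

nℚ-positive : ∀ Z .{{_ : NonZero Z}} → Positive (nℚ Z)
nℚ-positive Z = ℚ.normalize-pos Z 1

-- y = Y / Z
record Frac (y : ℚ) (Y Z : ℕ) : Set where
  constructor frac
  field scaled : y ℚ.* nℚ Z ≡ nℚ Y

frac-nℚ : ∀ a → Frac (nℚ a) a 1
frac-nℚ a = frac (ℚ.*-identityʳ (nℚ a))

frac-* : ∀ {x y X X′ Y Y′} → Frac x X X′ → Frac y Y Y′ → Frac (x ℚ.* y) (X * Y) (X′ * Y′)
frac-* {x} {y} {X} {X′} {Y} {Y′} (frac fx) (frac fy) = frac (begin
  x ℚ.* y ℚ.* nℚ (X′ * Y′)              ≡⟨ cong (x ℚ.* y ℚ.*_) (nℚ-* X′ Y′) ⟩
  x ℚ.* y ℚ.* (nℚ X′ ℚ.* nℚ Y′)         ≡⟨ interchange x y (nℚ X′) (nℚ Y′) ⟩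
  (x ℚ.* nℚ X′) ℚ.* (y ℚ.* nℚ Y′)       ≡⟨ cong₂ ℚ._*_ fx fy ⟩
  nℚ X ℚ.* nℚ Y                         ≡⟨ nℚ-* X Y ⟨
  nℚ (X * Y)                            ∎)
  where
  open ≡-Reasoning
  open +-*-Solver
  interchange : ∀ x y a b → x ℚ.* y ℚ.* (a ℚ.* b) ≡ (x ℚ.* a) ℚ.* (y ℚ.* b)
  interchange = solve 4 (λ x y a b → x :* y :* (a :* b) := (x :* a) :* (y :* b)) refl

frac-^ : ∀ k {x X X′} → Frac x X X′ → Frac (x ^ℚ k) (X ^ k) (X′ ^ k)
frac-^ zero    fx = frac refl
frac-^ (suc k) fx = frac-* fx (frac-^ k fx)

module _ {x y X X′ Y Y′} .{{_ : NonZero X′}} .{{_ : NonZero Y′}} (fx : Frac x X X′) (fy : Frac y Y Y′) where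

  private
    instance
      positive : Positive (nℚ (X′ * Y′))
      positive = nℚ-positive (X′ * Y′) {{m*n≢0 X′ Y′}}

    scale-x : x ℚ.* nℚ (X′ * Y′) ≡ nℚ (X * Y′)
    scale-x = begin
      x ℚ.* nℚ (X′ * Y′)             ≡⟨ cong (x ℚ.*_) (nℚ-* X′ Y′) ⟩
      x ℚ.* (nℚ X′ ℚ.* nℚ Y′)        ≡⟨ ℚ.*-assoc x _ _ ⟨
      x ℚ.* nℚ X′ ℚ.* nℚ Y′          ≡⟨ cong (ℚ._* nℚ Y′) (Frac.scaled fx) ⟩
      nℚ X ℚ.* nℚ Y′                 ≡⟨ nℚ-* X Y′ ⟨
      nℚ (X * Y′)                    ∎
      where open ≡-Reasoning

    scale-y : y ℚ.* nℚ (X′ * Y′) ≡ nℚ (Y * X′)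
    scale-y = begin
      y ℚ.* nℚ (X′ * Y′)             ≡⟨ cong (λ t → y ℚ.* nℚ t) (*-comm X′ Y′) ⟩
      y ℚ.* nℚ (Y′ * X′)             ≡⟨ cong (y ℚ.*_) (nℚ-* Y′ X′) ⟩
      y ℚ.* (nℚ Y′ ℚ.* nℚ X′)        ≡⟨ ℚ.*-assoc y _ _ ⟨
      y ℚ.* nℚ Y′ ℚ.* nℚ X′          ≡⟨ cong (ℚ._* nℚ X′) (Frac.scaled fy) ⟩
      nℚ Y ℚ.* nℚ X′                 ≡⟨ nℚ-* Y X′ ⟨
      nℚ (Y * X′)                    ∎
      where open ≡-Reasoning

  frac-≤⁺ : X * Y′ ≤ Y * X′ → x ℚ.≤ y
  frac-≤⁺ le = ℚ.*-cancelʳ-≤-pos (nℚ (X′ * Y′)) (subst₂ ℚ._≤_ (sym scale-x) (sym scale-y) (nℚ-mono-≤ le))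

  frac-≤⁻ : x ℚ.≤ y → X * Y′ ≤ Y * X′
  frac-≤⁻ le = nℚ-cancel-≤ (subst₂ ℚ._≤_ scale-x scale-y
    (ℚ.*-monoʳ-≤-nonNeg (nℚ (X′ * Y′)) {{ℚ.pos⇒nonNeg (nℚ (X′ * Y′))}} le))

  frac-<⁺ : X * Y′ < Y * X′ → x ℚ.< y
  frac-<⁺ lt = ℚ.*-cancelʳ-<-nonNeg (nℚ (X′ * Y′)) {{ℚ.pos⇒nonNeg (nℚ (X′ * Y′))}}
    (subst₂ ℚ._<_ (sym scale-x) (sym scale-y) (nℚ-mono-< lt))

  frac-<⁻ : x ℚ.< y → X * Y′ < Y * X′
  frac-<⁻ lt = nℚ-cancel-< (subst₂ ℚ._<_ scale-x scale-y (ℚ.*-monoˡ-<-pos (nℚ (X′ * Y′)) lt))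

-- x = (u − v) / b
record SFrac (x : ℚ) (u v b : ℕ) : Set where
  constructor sfrac
  field scaled : x ℚ.* nℚ b ℚ.+ nℚ v ≡ nℚ u

fromℚᵘ-frac : ∀ a b-1 → Frac (fromℚᵘ (mkℚᵘ (ℤ.+ a) b-1)) a (suc b-1)
fromℚᵘ-frac a b-1 = frac (trans (sym (fromℚᵘ-* (mkℚᵘ (ℤ.+ a) b-1) (mkℚᵘ (ℤ.+ suc b-1) 0)))
  (ℚ.fromℚᵘ-cong {mkℚᵘ (ℤ.+ a) b-1 ℚᵘ.* mkℚᵘ (ℤ.+ suc b-1) 0} {mkℚᵘ (ℤ.+ a) 0}
    (*≡* (trans (ℤ.*-identityʳ _) (cong (λ t → ℤ.+ a ℤ.* ℤ.+ suc t) (sym (*-identityʳ b-1)))))))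

frac⇒sfrac : ∀ {x a b} → Frac x a b → SFrac x a 0 b
frac⇒sfrac (frac fx) = sfrac (trans (ℚ.+-identityʳ _) fx)

nonNeg-frac : ∀ k d .(c : Coprime k (suc d)) → Frac (mkℚ (ℤ.+ k) d c) k (suc d)
nonNeg-frac k d c = subst (λ x → Frac x k (suc d)) (ℚ.fromℚᵘ-toℚᵘ (mkℚ (ℤ.+ k) d c)) (fromℚᵘ-frac k d)

neg-sfrac : ∀ k d .(c : Coprime (suc k) (suc d)) → SFrac (mkℚ -[1+ k ] d c) 0 (suc k) (suc d)
neg-sfrac k d c = sfrac (begin
  x ℚ.* nℚ (suc d) ℚ.+ nℚ (suc k)
    ≡⟨⟩
  ℚ.- (ℚ.- x) ℚ.* nℚ (suc d) ℚ.+ nℚ (suc k)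
    ≡⟨ cong (ℚ._+ nℚ (suc k)) (ℚ.neg-distribˡ-* (ℚ.- x) (nℚ (suc d))) ⟨
  ℚ.- ((ℚ.- x) ℚ.* nℚ (suc d)) ℚ.+ nℚ (suc k)
    ≡⟨ cong (λ t → ℚ.- t ℚ.+ nℚ (suc k)) (Frac.scaled (nonNeg-frac (suc k) d c)) ⟩
  ℚ.- nℚ (suc k) ℚ.+ nℚ (suc k)
    ≡⟨ ℚ.+-inverseˡ (nℚ (suc k)) ⟩
  nℚ 0 ∎)
  where
  open ≡-Reasoning
  x = mkℚ -[1+ k ] d c

sfrac-unique : ∀ {x u v b u′ v′ b′} → SFrac x u v b → SFrac x u′ v′ b′ → u * b′ + v′ * b ≡ u′ * b + v * b′
sfrac-unique {x} {u} {v} {b} {u′} {v′} {b′} (sfrac f) (sfrac f′) = nℚ-injective (begin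
  nℚ (u * b′ + v′ * b)
    ≡⟨ homo u b′ v′ b ⟩
  nℚ u ℚ.* nℚ b′ ℚ.+ nℚ v′ ℚ.* nℚ b
    ≡⟨ cong (λ t → t ℚ.* nℚ b′ ℚ.+ nℚ v′ ℚ.* nℚ b) f ⟨
  (x ℚ.* nℚ b ℚ.+ nℚ v) ℚ.* nℚ b′ ℚ.+ nℚ v′ ℚ.* nℚ b
    ≡⟨ shuffle x (nℚ b) (nℚ v) (nℚ b′) (nℚ v′) ⟩
  (x ℚ.* nℚ b′ ℚ.+ nℚ v′) ℚ.* nℚ b ℚ.+ nℚ v ℚ.* nℚ b′
    ≡⟨ cong (λ t → t ℚ.* nℚ b ℚ.+ nℚ v ℚ.* nℚ b′) f′ ⟩
  nℚ u′ ℚ.* nℚ b ℚ.+ nℚ v ℚ.* nℚ b′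
    ≡⟨ homo u′ b v b′ ⟨
  nℚ (u′ * b + v * b′) ∎)
  where
  open ≡-Reasoning
  homo : ∀ a b c d → nℚ (a * b + c * d) ≡ nℚ a ℚ.* nℚ b ℚ.+ nℚ c ℚ.* nℚ d
  homo a b c d = trans (nℚ-+ (a * b) (c * d)) (cong₂ ℚ._+_ (nℚ-* a b) (nℚ-* c d))
  open +-*-Solver
  shuffle : ∀ x b v b′ v′ → (x ℚ.* b ℚ.+ v) ℚ.* b′ ℚ.+ v′ ℚ.* b ≡ (x ℚ.* b′ ℚ.+ v′) ℚ.* b ℚ.+ v ℚ.* b′
  shuffle = solve 5 (λ x b v b′ v′ → (x :* b :+ v) :* b′ :+ v′ :* b := (x :* b′ :+ v′) :* b :+ v :* b′) refl

sfrac-neg : ∀ {x u v b} → SFrac x u v b → SFrac (ℚ.- x) v u b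
sfrac-neg {x} {u} {v} {b} (sfrac f) = sfrac (trans (cong (ℚ.- x ℚ.* nℚ b ℚ.+_) (sym f)) (cancel x (nℚ b) (nℚ v)))
  where
  open +-*-Solver
  cancel : ∀ x b v → ℚ.- x ℚ.* b ℚ.+ (x ℚ.* b ℚ.+ v) ≡ v
  cancel = solve 3 (λ x b v → :- x :* b :+ (x :* b :+ v) := v) refl

-- 2^((u − v)/b) P ≤ R does not depend on how the exponent is written as a fraction.
module _ {x u v b u′ v′ b′} (f : SFrac x u v b) (f′ : SFrac x u′ v′ b′) (P R : ℕ) where

  private
    same : u′ * b + v * b′ ≡ u * b′ + v′ * b
    same = sfrac-unique f′ f

    lhs : (2 ^ u′ * P ^ b′) ^ b * 2 ^ (v * b′) ≡ (2 ^ u * P ^ b) ^ b′ * 2 ^ (v′ * b)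
    lhs = begin
      (2 ^ u′ * P ^ b′) ^ b * 2 ^ (v * b′)
        ≡⟨ cong (_* 2 ^ (v * b′)) (trans (^-distribʳ-* b (2 ^ u′) (P ^ b′)) (cong (_* (P ^ b′) ^ b) (^-*-assoc 2 u′ b))) ⟩
      2 ^ (u′ * b) * (P ^ b′) ^ b * 2 ^ (v * b′)
        ≡⟨ exchange (2 ^ (u′ * b)) ((P ^ b′) ^ b) (2 ^ (v * b′)) ⟩
      2 ^ (u′ * b) * 2 ^ (v * b′) * (P ^ b′) ^ b
        ≡⟨ cong (_* (P ^ b′) ^ b) (sym (^-distribˡ-+-* 2 (u′ * b) (v * b′))) ⟩
      2 ^ (u′ * b + v * b′) * (P ^ b′) ^ b
        ≡⟨ cong₂ (λ s t → 2 ^ s * t) same (^-swap P b′ b) ⟩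
      2 ^ (u * b′ + v′ * b) * (P ^ b) ^ b′
        ≡⟨ cong (_* (P ^ b) ^ b′) (^-distribˡ-+-* 2 (u * b′) (v′ * b)) ⟩
      2 ^ (u * b′) * 2 ^ (v′ * b) * (P ^ b) ^ b′
        ≡⟨ exchange (2 ^ (u * b′)) (2 ^ (v′ * b)) ((P ^ b) ^ b′) ⟩
      2 ^ (u * b′) * (P ^ b) ^ b′ * 2 ^ (v′ * b)
        ≡⟨ cong (_* 2 ^ (v′ * b)) (trans (^-distribʳ-* b′ (2 ^ u) (P ^ b)) (cong (_* (P ^ b) ^ b′) (^-*-assoc 2 u b′))) ⟨
      (2 ^ u * P ^ b) ^ b′ * 2 ^ (v′ * b) ∎
      where
      open ≡-Reasoning
      exchange : ∀ x y z → x * y * z ≡ x * z * y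
      exchange = solve-∀

    rhs : (R ^ b * 2 ^ v) ^ b′ * 2 ^ (v′ * b) ≡ (R ^ b′ * 2 ^ v′) ^ b * 2 ^ (v * b′)
    rhs = begin
      (R ^ b * 2 ^ v) ^ b′ * 2 ^ (v′ * b)
        ≡⟨ cong (_* 2 ^ (v′ * b)) (trans (^-distribʳ-* b′ (R ^ b) (2 ^ v)) (cong₂ _*_ (^-swap R b b′) (^-*-assoc 2 v b′))) ⟩
      (R ^ b′) ^ b * 2 ^ (v * b′) * 2 ^ (v′ * b)
        ≡⟨ exchange ((R ^ b′) ^ b) (2 ^ (v * b′)) (2 ^ (v′ * b)) ⟩
      (R ^ b′) ^ b * 2 ^ (v′ * b) * 2 ^ (v * b′)
        ≡⟨ cong (_* 2 ^ (v * b′)) (trans (^-distribʳ-* b (R ^ b′) (2 ^ v′)) (cong ((R ^ b′) ^ b *_) (^-*-assoc 2 v′ b))) ⟨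
      (R ^ b′ * 2 ^ v′) ^ b * 2 ^ (v * b′) ∎
      where
      open ≡-Reasoning
      exchange : ∀ x y z → x * y * z ≡ x * z * y
      exchange = solve-∀

  -- Raised to the powers b′ and b and multiplied by 2^(v′ b) and 2^(v b′), the two inequalities
  -- coincide.
  transfer-≤ : .{{_ : NonZero b}} → 2 ^ u * P ^ b ≤ R ^ b * 2 ^ v → 2 ^ u′ * P ^ b′ ≤ R ^ b′ * 2 ^ v′
  transfer-≤ le = ^-cancelʳ-≤ b (*-cancelʳ-≤ _ _ (2 ^ (v * b′)) {{m^n≢0 2 (v * b′)}}
    (subst₂ _≤_ (sym lhs) rhs (*-monoˡ-≤ (2 ^ (v′ * b)) (^-monoˡ-≤ b′ le))))

  transfer-< : .{{_ : NonZero b′}} → 2 ^ u * P ^ b < R ^ b * 2 ^ v → 2 ^ u′ * P ^ b′ < R ^ b′ * 2 ^ v′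
  transfer-< lt = ^-cancelʳ-< b (*-cancelʳ-< (2 ^ (v * b′)) _ _
    (subst₂ _<_ (sym lhs) rhs (*-monoˡ-< (2 ^ (v′ * b)) {{m^n≢0 2 (v′ * b)}} (^-monoˡ-< b′ lt))))

nℚ-^ : ∀ a k → nℚ a ^ℚ k ≡ nℚ (a ^ k)
nℚ-^ a zero    = refl
nℚ-^ a (suc k) = trans (cong (nℚ a ℚ.*_) (nℚ-^ a k)) (sym (nℚ-* a (a ^ k)))

frac-nℚ^ : ∀ a k → Frac (nℚ a ^ℚ k) (a ^ k) 1
frac-nℚ^ a k = frac (trans (ℚ.*-identityʳ _) (nℚ-^ a k))

Pow2≤-intro : ∀ x {y Y Z u v b} .{{_ : NonZero Z}} .{{_ : NonZero b}} → Frac y Y Z → SFrac x u v b →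
  2 ^ u * Z ^ b ≤ Y ^ b * 2 ^ v → Pow2≤ 1ℚ x y
Pow2≤-intro (mkℚ (ℤ.+ k) d c) {y} {Y} {Z} {u} {v} {b} fy fx le =
  frac-≤⁺ {{_}} {{m^n≢0 Z (suc d)}}
    (frac-* (frac-nℚ^ 1 (suc d)) (frac-nℚ^ 2 k)) (frac-^ (suc d) fy)
    (subst₂ _≤_ (cong (_* Z ^ suc d) (sym (1^*x (suc d) (2 ^ k)))) refl
      (transfer-≤ fx (frac⇒sfrac (nonNeg-frac k d c)) Z Y le))
  where
  1^*x : ∀ k x → 1 ^ k * x ≡ x
  1^*x k x = trans (cong (_* x) (^-zeroˡ k)) (+-identityʳ x)
Pow2≤-intro (mkℚ -[1+ k ] d c) {y} {Y} {Z} {u} {v} {b} fy fx le =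
  frac-≤⁺ {{_}} {{m*n≢0 (Z ^ suc d) 1 {{m^n≢0 Z (suc d)}}}}
    (frac-nℚ^ 1 (suc d)) (frac-* (frac-^ (suc d) fy) (frac-nℚ^ 2 (suc k)))
    (subst₂ _≤_ (cong₂ _*_ (sym (^-zeroˡ (suc d))) (sym (*-identityʳ (Z ^ suc d)))) (sym (*-identityʳ _))
      (transfer-≤ fx (neg-sfrac k d c) Z Y le))

Pow2<-intro : ∀ r {n m a b} .{{_ : NonZero b}} → Frac r a b →
  2 ^ a * n ^ b < m ^ b → Pow2< (nℚ n) r (nℚ m)
Pow2<-intro (mkℚ (ℤ.+ k) d c) {n} {m} {a} {b} fr lt =
  frac-<⁺ (frac-* (frac-nℚ^ n (suc d)) (frac-nℚ^ 2 k)) (frac-nℚ^ m (suc d))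
    (subst₂ _<_ (trans (*-comm (2 ^ k) _) (sym (*-identityʳ _))) refl
      (transfer-< (frac⇒sfrac fr) (frac⇒sfrac (nonNeg-frac k d c)) n m
        (subst (2 ^ a * n ^ b <_) (sym (*-identityʳ (m ^ b))) lt)))
Pow2<-intro (mkℚ -[1+ k ] d c) {n} {m} {a} {b} fr lt =
  frac-<⁺ (frac-nℚ^ n (suc d)) (frac-* (frac-nℚ^ m (suc d)) (frac-nℚ^ 2 (suc k)))
    (subst₂ _<_ (trans (+-identityʳ _) (sym (*-identityʳ _))) (sym (*-identityʳ _))
      (transfer-< (frac⇒sfrac fr) (neg-sfrac k d c) n m
        (subst (2 ^ a * n ^ b <_) (sym (*-identityʳ (m ^ b))) lt)))

≤Pow2-elim : ∀ x {y Y Z u v b} .{{_ : NonZero Z}} → Frac y Y Z → SFrac x u v b →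
  ≤Pow2 y x → 2 ^ v * Y ^ b ≤ Z ^ b * 2 ^ u
≤Pow2-elim (mkℚ (ℤ.+ k) d c) {y} {Y} {Z} {u} {v} {b} fy fx le =
  -- y ≤ 2^x is read as 2^(-x) Y ≤ Z, hence the negated exponents.
  transfer-≤ (sfrac-neg (frac⇒sfrac (nonNeg-frac k d c))) (sfrac-neg fx) Y Z
    (subst₂ _≤_ (trans (*-identityʳ _) (sym (+-identityʳ _))) (*-comm (2 ^ k) _)
      (frac-≤⁻ {{m^n≢0 Z (suc d)}} {{_}} (frac-^ (suc d) fy) (frac-nℚ^ 2 k) le))
≤Pow2-elim (mkℚ -[1+ k ] d c) {y} {Y} {Z} {u} {v} {b} fy fx le =
  transfer-≤ (sfrac-neg (neg-sfrac k d c)) (sfrac-neg fx) Y Z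
    (subst₂ _≤_ (trans (*-identityʳ _) (*-comm _ (2 ^ suc k)))
                (trans (+-identityʳ _) refl)
      (frac-≤⁻ {{m*n≢0 (Z ^ suc d) 1 {{m^n≢0 Z (suc d)}}}} {{_}}
        (frac-* (frac-^ (suc d) fy) (frac-nℚ^ 2 (suc k))) (frac-nℚ 1) le))

-- The bounds

nat-minus-frac : ∀ N {r p⁺ p⁻ D w} → SFrac r p⁺ p⁻ D → w + p⁺ ≡ N * D + p⁻ → Frac (nℚ N ℚ.- r) w D
nat-minus-frac N {r} {p⁺} {p⁻} {D} {w} (sfrac fr) eq = frac (begin
  (nℚ N ℚ.- r) ℚ.* nℚ D
    ≡⟨ shuffle (nℚ N) r (nℚ D) (nℚ p⁻) ⟩
  nℚ N ℚ.* nℚ D ℚ.+ nℚ p⁻ ℚ.- (r ℚ.* nℚ D ℚ.+ nℚ p⁻)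
    ≡⟨ cong (λ t → nℚ N ℚ.* nℚ D ℚ.+ nℚ p⁻ ℚ.- t) fr ⟩
  nℚ N ℚ.* nℚ D ℚ.+ nℚ p⁻ ℚ.- nℚ p⁺
    ≡⟨ cong (ℚ._- nℚ p⁺) (trans (sym (trans (nℚ-+ (N * D) p⁻) (cong (ℚ._+ nℚ p⁻) (nℚ-* N D))))
                                (trans (cong nℚ (sym eq)) (nℚ-+ w p⁺))) ⟩
  nℚ w ℚ.+ nℚ p⁺ ℚ.- nℚ p⁺
    ≡⟨ cancel (nℚ w) (nℚ p⁺) ⟩
  nℚ w ∎)
  where
  open ≡-Reasoning
  open +-*-Solver
  shuffle : ∀ N r D p → (N ℚ.- r) ℚ.* D ≡ N ℚ.* D ℚ.+ p ℚ.- (r ℚ.* D ℚ.+ p)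
  shuffle = solve 4 (λ N r D p → (N :- r) :* D := N :* D :+ p :- (r :* D :+ p)) refl
  cancel : ∀ w p → w ℚ.+ p ℚ.- p ≡ w
  cancel = solve 2 (λ w p → w :+ p :- p := w) refl

lower-exponent : ∀ m q {r p⁺ p⁻ D} → SFrac r p⁺ p⁻ D →
  SFrac (nℚ m ℚ.* (r ℚ.- 1ℚ) ℚ.- nℚ q) (p⁺ * m) ((q + m) * D + p⁻ * m) D
lower-exponent m q {r} {p⁺} {p⁻} {D} (sfrac fr) = sfrac (begin
  (nℚ m ℚ.* (r ℚ.- 1ℚ) ℚ.- nℚ q) ℚ.* nℚ D ℚ.+ nℚ ((q + m) * D + p⁻ * m)
    ≡⟨ cong ((nℚ m ℚ.* (r ℚ.- 1ℚ) ℚ.- nℚ q) ℚ.* nℚ D ℚ.+_) homo ⟩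
  (nℚ m ℚ.* (r ℚ.- 1ℚ) ℚ.- nℚ q) ℚ.* nℚ D ℚ.+ ((nℚ q ℚ.+ nℚ m) ℚ.* nℚ D ℚ.+ nℚ p⁻ ℚ.* nℚ m)
    ≡⟨ shuffle (nℚ m) r (nℚ q) (nℚ D) (nℚ p⁻) ⟩
  (r ℚ.* nℚ D ℚ.+ nℚ p⁻) ℚ.* nℚ m
    ≡⟨ cong (ℚ._* nℚ m) fr ⟩
  nℚ p⁺ ℚ.* nℚ m
    ≡⟨ nℚ-* p⁺ m ⟨
  nℚ (p⁺ * m) ∎)
  where
  open ≡-Reasoning
  homo : nℚ ((q + m) * D + p⁻ * m) ≡ (nℚ q ℚ.+ nℚ m) ℚ.* nℚ D ℚ.+ nℚ p⁻ ℚ.* nℚ m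
  homo = trans (nℚ-+ ((q + m) * D) (p⁻ * m))
    (cong₂ ℚ._+_ (trans (nℚ-* (q + m) D) (cong (ℚ._* nℚ D) (nℚ-+ q m))) (nℚ-* p⁻ m))
  open +-*-Solver
  shuffle : ∀ m r q D p → (m ℚ.* (r ℚ.- 1ℚ) ℚ.- q) ℚ.* D ℚ.+ ((q ℚ.+ m) ℚ.* D ℚ.+ p ℚ.* m) ≡ (r ℚ.* D ℚ.+ p) ℚ.* m
  shuffle = solve 5 (λ m r q D p →
    (m :* (r :- con 1ℚ) :- q) :* D :+ ((q :+ m) :* D :+ p :* m) := (r :* D :+ p) :* m) refl

upper-exponent : ∀ K {r a b} → Frac r a b → SFrac (nℚ K ℚ.- 1ℚ ℚ.- r) (K * b) (b + a) b
upper-exponent K {r} {a} {b} (frac fr) = sfrac (begin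
  (nℚ K ℚ.- 1ℚ ℚ.- r) ℚ.* nℚ b ℚ.+ nℚ (b + a)
    ≡⟨ cong ((nℚ K ℚ.- 1ℚ ℚ.- r) ℚ.* nℚ b ℚ.+_) (trans (nℚ-+ b a) (cong (nℚ b ℚ.+_) (sym fr))) ⟩
  (nℚ K ℚ.- 1ℚ ℚ.- r) ℚ.* nℚ b ℚ.+ (nℚ b ℚ.+ r ℚ.* nℚ b)
    ≡⟨ shuffle (nℚ K) r (nℚ b) ⟩
  nℚ K ℚ.* nℚ b
    ≡⟨ nℚ-* K b ⟨
  nℚ (K * b) ∎)
  where
  open ≡-Reasoning
  open +-*-Solver
  shuffle : ∀ K r b → (K ℚ.- 1ℚ ℚ.- r) ℚ.* b ℚ.+ (b ℚ.+ r ℚ.* b) ≡ K ℚ.* b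
  shuffle = solve 3 (λ K r b → (K :- con 1ℚ :- r) :* b :+ (b :+ r :* b) := K :* b) refl

module LowerBound {n m q A : ℕ} (covering : m ^ 2 ^ n * 2 ^ A ≤ (2 ^ suc n) ^ 2 ^ n)
                  (averaging : (2 ^ n * m) ^ m ≤ A ^ m * 2 ^ (q + m)) where
  open ≤-Reasoning

  private
    M = 2 ^ n

  module _ (p D : ℕ) (2^p<m^D : 2 ^ p < m ^ D) where

    -- With r = p / D < log m, `covering` gives r + A / M ≤ n + 1. Accordingly w / D below is n + 1
    -- - r, an upper bound for A / M.
    exponents : p * M + A * D ≤ suc n * D * M
    exponents = ^-cancelˡ-≤ 2 (s≤s (s≤s z≤n)) (begin
      2 ^ (p * M + A * D)          ≡⟨ ^-distribˡ-+-* 2 (p * M) (A * D) ⟩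
      2 ^ (p * M) * 2 ^ (A * D)    ≡⟨ cong₂ _*_ (^-*-assoc 2 p M) (^-*-assoc 2 A D) ⟨
      (2 ^ p) ^ M * (2 ^ A) ^ D    ≤⟨ *-monoˡ-≤ ((2 ^ A) ^ D) (^-monoˡ-≤ M (<⇒≤ 2^p<m^D)) ⟩
      (m ^ D) ^ M * (2 ^ A) ^ D    ≡⟨ cong (_* (2 ^ A) ^ D) (^-swap m D M) ⟩
      (m ^ M) ^ D * (2 ^ A) ^ D    ≡⟨ ^-distribʳ-* D (m ^ M) (2 ^ A) ⟨
      (m ^ M * 2 ^ A) ^ D          ≤⟨ ^-monoˡ-≤ D covering ⟩
      ((2 ^ suc n) ^ M) ^ D        ≡⟨ ^-swap (2 ^ suc n) M D ⟩
      ((2 ^ suc n) ^ D) ^ M        ≡⟨ cong (_^ M) (^-*-assoc 2 (suc n) D) ⟩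
      (2 ^ (suc n * D)) ^ M        ≡⟨ ^-*-assoc 2 (suc n * D) M ⟩
      2 ^ (suc n * D * M)          ∎)

    p≤[1+n]*D : p ≤ suc n * D
    p≤[1+n]*D = *-cancelʳ-≤ p (suc n * D) M {{m^n≢0 2 n}} (≤-trans (m≤m+n _ _) exponents)

    w = suc n * D ∸ p

    w+p : w + p ≡ suc n * D
    w+p = m∸n+n≡m p≤[1+n]*D

    A*D≤w*M : A * D ≤ w * M
    A*D≤w*M = +-cancelˡ-≤ (p * M) _ _ (begin
      p * M + A * D    ≤⟨ exponents ⟩
      suc n * D * M    ≡⟨ cong (_* M) w+p ⟨
      (w + p) * M      ≡⟨ *-distribʳ-+ M w p ⟩
      w * M + p * M    ≡⟨ +-comm (w * M) (p * M) ⟩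
      p * M + w * M    ∎)

    [m*D]^m≤ : (m * D) ^ m ≤ w ^ m * 2 ^ (q + m)
    [m*D]^m≤ = *-cancelˡ-≤ (M ^ m) {{m^n≢0 M m {{m^n≢0 2 n}}}} (begin
      M ^ m * (m * D) ^ m              ≡⟨ ^-distribʳ-* m M (m * D) ⟨
      (M * (m * D)) ^ m                ≡⟨ cong (_^ m) (*-assoc M m D) ⟨
      (M * m * D) ^ m                  ≡⟨ ^-distribʳ-* m (M * m) D ⟩
      (M * m) ^ m * D ^ m              ≤⟨ *-monoˡ-≤ (D ^ m) averaging ⟩
      A ^ m * 2 ^ (q + m) * D ^ m      ≡⟨ eq₁ (A ^ m) (2 ^ (q + m)) (D ^ m) ⟩
      A ^ m * D ^ m * 2 ^ (q + m)      ≡⟨ cong (_* 2 ^ (q + m)) (^-distribʳ-* m A D) ⟨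
      (A * D) ^ m * 2 ^ (q + m)        ≤⟨ *-monoˡ-≤ (2 ^ (q + m)) (^-monoˡ-≤ m A*D≤w*M) ⟩
      (w * M) ^ m * 2 ^ (q + m)        ≡⟨ cong (_* 2 ^ (q + m)) (^-distribʳ-* m w M) ⟩
      w ^ m * M ^ m * 2 ^ (q + m)      ≡⟨ eq₂ (w ^ m) (M ^ m) (2 ^ (q + m)) ⟩
      M ^ m * (w ^ m * 2 ^ (q + m))    ∎)
      where
      eq₁ : ∀ a b c → a * b * c ≡ a * c * b
      eq₁ = solve-∀
      eq₂ : ∀ a b c → a * b * c ≡ b * (a * c)
      eq₂ = solve-∀

    -- The summand 0 is the term `p⁻ * m` of `lower-exponent` for a nonnegative r.
    bound : 2 ^ (p * m) * (D ^ m) ^ D ≤ (w ^ m) ^ D * 2 ^ ((q + m) * D + 0)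
    bound = begin
      2 ^ (p * m) * (D ^ m) ^ D        ≡⟨ cong (_* (D ^ m) ^ D) (^-*-assoc 2 p m) ⟨
      (2 ^ p) ^ m * (D ^ m) ^ D        ≤⟨ *-monoˡ-≤ ((D ^ m) ^ D) (^-monoˡ-≤ m (<⇒≤ 2^p<m^D)) ⟩
      (m ^ D) ^ m * (D ^ m) ^ D        ≡⟨ cong (_* (D ^ m) ^ D) (^-swap m D m) ⟩
      (m ^ m) ^ D * (D ^ m) ^ D        ≡⟨ ^-distribʳ-* D (m ^ m) (D ^ m) ⟨
      (m ^ m * D ^ m) ^ D              ≡⟨ cong (_^ D) (^-distribʳ-* m m D) ⟨
      ((m * D) ^ m) ^ D                ≤⟨ ^-monoˡ-≤ D [m*D]^m≤ ⟩
      (w ^ m * 2 ^ (q + m)) ^ D        ≡⟨ ^-distribʳ-* D (w ^ m) (2 ^ (q + m)) ⟩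
      (w ^ m) ^ D * (2 ^ (q + m)) ^ D  ≡⟨ cong ((w ^ m) ^ D *_) (^-*-assoc 2 (q + m) D) ⟩
      (w ^ m) ^ D * 2 ^ ((q + m) * D)  ≡⟨ cong (λ t → (w ^ m) ^ D * 2 ^ t) (+-identityʳ ((q + m) * D)) ⟨
      (w ^ m) ^ D * 2 ^ ((q + m) * D + 0) ∎

  holds : LowerBoundHolds n m q
  holds (mkℚ (ℤ.+ p) d c) 2^r<m =
    Pow2≤-intro _ {{m^n≢0 (suc d) m}}
      (frac-^ m (nat-minus-frac (suc n) fr (trans (w+p p (suc d) 2^p<) (sym (+-identityʳ _)))))
      (lower-exponent m q fr) (bound p (suc d) 2^p<)
    where
    fr = frac⇒sfrac (nonNeg-frac p d c)
    2^p< : 2 ^ p < m ^ suc d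
    2^p< = subst₂ _<_
      (trans (*-identityʳ _) (trans (cong (_* 2 ^ p) (^-zeroˡ (suc d))) (+-identityʳ (2 ^ p))))
      (*-identityʳ _)
      (frac-<⁻ (frac-* (frac-nℚ^ 1 (suc d)) (frac-nℚ^ 2 p)) (frac-nℚ^ m (suc d)) 2^r<m)
  -- For r < 0 the power of two is at most 1, while n + 1 - r is at least 1.
  holds (mkℚ -[1+ k ] d c) _ =
    Pow2≤-intro _ {{m^n≢0 (suc d) m}} (frac-^ m (nat-minus-frac (suc n) fr (+-identityʳ _)))
      (lower-exponent m q fr) (begin
        2 ^ 0 * (suc d ^ m) ^ suc d                 ≡⟨ +-identityʳ _ ⟩
        (suc d ^ m) ^ suc d                         ≤⟨ ^-monoˡ-≤ (suc d) (^-monoˡ-≤ m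
                                                        (≤-trans (m≤m+n (suc d) _) (m≤m+n _ (suc k)))) ⟩
        ((suc n * suc d + suc k) ^ m) ^ suc d       ≤⟨ m≤m*n _ (2 ^ v) {{m^n≢0 2 v}} ⟩
        ((suc n * suc d + suc k) ^ m) ^ suc d * 2 ^ v ∎)
    where
    fr = neg-sfrac k d c
    v = (q + m) * suc d + suc k * m

  -- From m ≥ 2 and `covering`, A / M ≤ n. The denominator n in place of n + 1 - log m is good
  -- enough for the asymptotic bound.
  m^m≤n^m*2^[q+m] : 2 ≤ m → m ^ m ≤ n ^ m * 2 ^ (q + m)
  m^m≤n^m*2^[q+m] 2≤m = *-cancelˡ-≤ (M ^ m) {{m^n≢0 M m {{m^n≢0 2 n}}}} (begin
    M ^ m * m ^ m                 ≡⟨ ^-distribʳ-* m M m ⟨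
    (M * m) ^ m                   ≤⟨ averaging ⟩
    A ^ m * 2 ^ (q + m)           ≤⟨ *-monoˡ-≤ (2 ^ (q + m)) (^-monoˡ-≤ m A≤n*M) ⟩
    (n * M) ^ m * 2 ^ (q + m)     ≡⟨ cong (_* 2 ^ (q + m)) (trans (cong (_^ m) (*-comm n M)) (^-distribʳ-* m M n)) ⟩
    M ^ m * n ^ m * 2 ^ (q + m)   ≡⟨ *-assoc (M ^ m) (n ^ m) _ ⟩
    M ^ m * (n ^ m * 2 ^ (q + m)) ∎)
    where
    A≤n*M : A ≤ n * M
    A≤n*M = ^-cancelˡ-≤ 2 (s≤s (s≤s z≤n)) (*-cancelˡ-≤ (2 ^ M) {{m^n≢0 2 M}} (begin
      2 ^ M * 2 ^ A          ≤⟨ *-monoˡ-≤ (2 ^ A) (^-monoˡ-≤ M 2≤m) ⟩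
      m ^ M * 2 ^ A          ≤⟨ covering ⟩
      (2 * M) ^ M            ≡⟨ ^-distribʳ-* M 2 M ⟩
      2 ^ M * M ^ M          ≡⟨ cong (2 ^ M *_) (^-*-assoc 2 n M) ⟩
      2 ^ M * 2 ^ (n * M)    ∎))

lower-bound : ∀ {n m q} → 1 ≤ m → Solvable n m q → LowerBoundHolds n m q
lower-bound {n} {m} {q} 1≤m solv =
  let A , covering , averaging = lower-core 1≤m solv in
  LowerBound.holds {n} {m} {q} {A} covering averaging

-- The number of blocks, and the values of K for which they do not suffice.

-- For n ≤ K everything is queried: one block of all n columns, enough because m < 2^n. Otherwise q
-- ≥ 1, so the at most k leftover columns number at most k * q.
blocks-or-all : ∀ n m k → 1 ≤ n → m < 2 ^ n → suc (k + k) * m ≤ n * (2 ^ suc k ∸ 1) → Solvable n m (m * suc k)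
blocks-or-all n@(suc n-1) m k 1≤n m<2^n le with n ≤? suc k
... | yes n≤K = Solvable-mono (*-monoʳ-≤ m n≤K)
  (blocks-solvable n m n-1 1 (≤-reflexive (+-identityʳ n))
    (≤-trans (<⇒≤pred m<2^n) (≤-reflexive (sym (+-identityʳ _)))))
... | no  n≰K = blocks-solvable n m k q (m/n*n≤m n K) (*-cancelˡ-≤ (suc (k + k)) (begin
    suc (k + k) * m                    ≤⟨ le ⟩
    n * (2 ^ K ∸ 1)                    ≤⟨ *-monoˡ-≤ (2 ^ K ∸ 1) n≤ ⟩
    suc (k + k) * q * (2 ^ K ∸ 1)      ≡⟨ *-assoc (suc (k + k)) q _ ⟩
    suc (k + k) * (q * (2 ^ K ∸ 1))    ∎))
  where
  open ≤-Reasoning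
  K = suc k
  q = n / K
  n≤ : n ≤ suc (k + k) * q
  n≤ = begin
    n                    ≡⟨ m≡m%n+[m/n]*n n K ⟩
    n % K + q * K        ≤⟨ +-monoˡ-≤ (q * K) (s≤s⁻¹ (m%n<n n K)) ⟩
    k + q * K            ≤⟨ +-monoˡ-≤ (q * K) (m≤m*n k q {{>-nonZero (m≥n⇒m/n>0 (<⇒≤ (≰⇒> n≰K)))}}) ⟩
    k * q + q * K        ≡⟨ eq k q ⟩
    suc (k + k) * q      ∎
    where
    eq : ∀ k q → k * q + q * (1 + k) ≡ (1 + (k + k)) * q
    eq = solve-∀

-- With r = a / b the conclusion is 2^(1 + r) r² ≤ 2^K raised to the power b.
ceil-at : ∀ n m K a b .{{_ : NonZero b}} → b < a → 2 ^ a * n ^ b < (2 * m) ^ b → CeilUpperAtMost n m K →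
  2 ^ (b + a) * (a * a) ^ b ≤ (b * b) ^ b * 2 ^ (K * b)
ceil-at n m K a b@(suc b-1) b<a lt ceil =
  ≤Pow2-elim (nℚ K ℚ.- 1ℚ ℚ.- r) (frac-* fr fr) (upper-exponent K fr)
    (ceil r (frac-<⁺ (frac-nℚ 1) fr (subst₂ _<_ (sym (+-identityʳ b)) (sym (*-identityʳ a)) b<a))
            (Pow2<-intro r {n} {2 * m} fr lt))
  where
  r = fromℚᵘ (mkℚᵘ (ℤ.+ a) b-1)
  fr = fromℚᵘ-frac a b-1

-- As log(2m/n) > 1, the rounded quantity exceeds 2. The witness r = 1 + 1/(n + 1) lies below
-- log(2m/n) because (1 + 1/n)^(n + 1) > 2.
3≤ceil : ∀ n m K → 1 ≤ n → n < m → CeilUpperAtMost n m K → 3 ≤ K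
3≤ceil n m K 1≤n n<m ceil = ≰⇒> λ K≤2 → <⇒≱ (too-small K≤2) (ceil-at n m K a b ≤-refl close ceil)
  where
  open ≤-Reasoning
  a = suc (suc n)
  b = suc n
  growth : 2 * n ^ suc n < m ^ suc n
  growth = begin-strict
    2 * n ^ suc n                            <⟨ m<m+n _ (m^n>0 n {{>-nonZero 1≤n}} n) ⟩
    2 * n ^ suc n + n ^ n                    ≡⟨ eq n (n ^ n) ⟩
    n ^ suc n + suc n * (n ^ n * 1)          ≤⟨ bernoulli n n 1 ⟩
    (n + 1) ^ suc n                          ≤⟨ ^-monoˡ-≤ (suc n) (≤-trans (≤-reflexive (+-comm n 1)) n<m) ⟩
    m ^ suc n                                ∎
    where
    eq : ∀ n x → 2 * (n * x) + x ≡ n * x + (1 + n) * (x * 1)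
    eq = solve-∀
  close : 2 ^ a * n ^ b < (2 * m) ^ b
  close = begin-strict
    2 ^ a * n ^ b              ≡⟨ eq (2 ^ b) (n ^ b) ⟩
    2 ^ b * (2 * n ^ b)        <⟨ *-monoʳ-< (2 ^ b) {{m^n≢0 2 b}} growth ⟩
    2 ^ b * m ^ b              ≡⟨ ^-distribʳ-* b 2 m ⟨
    (2 * m) ^ b                ∎
    where
    eq : ∀ x y → 2 * x * y ≡ x * (2 * y)
    eq = solve-∀
  too-small : K ≤ 2 → (b * b) ^ b * 2 ^ (K * b) < 2 ^ (b + a) * (a * a) ^ b
  too-small K≤2 = begin-strict
    (b * b) ^ b * 2 ^ (K * b)    ≤⟨ *-mono-≤ (^-monoˡ-≤ b (*-mono-≤ (n≤1+n b) (n≤1+n b))) (^-monoʳ-≤ 2 (*-monoˡ-≤ b K≤2)) ⟩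
    (a * a) ^ b * 2 ^ (2 * b)    <⟨ *-monoʳ-< ((a * a) ^ b) {{m^n≢0 (a * a) b}} (^-monoʳ-< 2 (s≤s (s≤s z≤n)) 2b<b+a) ⟩
    (a * a) ^ b * 2 ^ (b + a)    ≡⟨ *-comm ((a * a) ^ b) _ ⟩
    2 ^ (b + a) * (a * a) ^ b    ∎
    where
    2b<b+a : 2 * b < b + a
    2b<b+a = +-monoʳ-< b (s≤s (≤-reflexive (+-identityʳ b)))

-- K = 3 and K = 5 are refuted by r = 4/3 and r = 5/2; there no integer r will do.
ceil≢3 : ∀ n m → n * 7 < 5 * m → ¬ CeilUpperAtMost n m 3
ceil≢3 n m lt ceil = contradiction (ceil-at n m 3 4 3 ≤-refl close ceil)
  (from-no (2 ^ 7 * 16 ^ 3 ≤? 9 ^ 3 * 2 ^ 9))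
  where
  open ≤-Reasoning
  4n<3m : 4 * n < 3 * m
  4n<3m = *-cancelˡ-< 7 _ _ (begin-strict
    7 * (4 * n)      ≡⟨ eq₁ n ⟩
    4 * (n * 7)      <⟨ *-monoʳ-< 4 lt ⟩
    4 * (5 * m)      ≤⟨ m≤m+n _ m ⟩
    4 * (5 * m) + m  ≡⟨ eq₂ m ⟩
    7 * (3 * m)      ∎)
    where
    eq₁ : ∀ n → 7 * (4 * n) ≡ 4 * (n * 7)
    eq₁ = solve-∀
    eq₂ : ∀ m → 4 * (5 * m) + m ≡ 7 * (3 * m)
    eq₂ = solve-∀
  close : 2 ^ 4 * n ^ 3 < (2 * m) ^ 3
  close = *-cancelˡ-< 4 _ _ (begin-strict
    4 * (2 ^ 4 * n ^ 3)             ≡⟨ eq₁ n ⟩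
    (4 * n) ^ 3                     <⟨ ^-monoˡ-< 3 4n<3m ⟩
    (3 * m) ^ 3                     ≤⟨ m≤m+n _ _ ⟩
    (3 * m) ^ 3 + 5 * (m * (m * m)) ≡⟨ eq₂ m ⟩
    4 * (2 * m) ^ 3                 ∎)
    where
    eq₁ : ∀ n → 4 * (16 * (n * (n * (n * 1)))) ≡ 4 * n * (4 * n * (4 * n * 1))
    eq₁ = solve-∀
    eq₂ : ∀ m → 3 * m * (3 * m * (3 * m * 1)) + 5 * (m * (m * m)) ≡ 4 * (2 * m * (2 * m * (2 * m * 1)))
    eq₂ = solve-∀

ceil≢5 : ∀ n m → n * 31 < 9 * m → ¬ CeilUpperAtMost n m 5
ceil≢5 n m lt ceil = contradiction (ceil-at n m 5 5 2 (s≤s (s≤s (s≤s z≤n))) close ceil)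
  (from-no (2 ^ 7 * 25 ^ 2 ≤? 4 ^ 2 * 2 ^ 10))
  where
  open ≤-Reasoning
  -- m/n > 31/9 > 3 suffices for r = 5/2, since 2^5 < 6^2.
  6n<2m : 6 * n < 2 * m
  6n<2m = *-cancelˡ-< 31 _ _ (begin-strict
    31 * (6 * n)          ≡⟨ eq₁ n ⟩
    6 * (n * 31)          <⟨ *-monoʳ-< 6 lt ⟩
    6 * (9 * m)           ≤⟨ m≤m+n _ (8 * m) ⟩
    6 * (9 * m) + 8 * m   ≡⟨ eq₂ m ⟩
    31 * (2 * m)          ∎)
    where
    eq₁ : ∀ n → 31 * (6 * n) ≡ 6 * (n * 31)
    eq₁ = solve-∀
    eq₂ : ∀ m → 6 * (9 * m) + 8 * m ≡ 31 * (2 * m)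
    eq₂ = solve-∀
  close : 2 ^ 5 * n ^ 2 < (2 * m) ^ 2
  close = begin-strict
    2 ^ 5 * n ^ 2                ≤⟨ m≤m+n _ _ ⟩
    2 ^ 5 * n ^ 2 + 4 * (n * n)  ≡⟨ eq n ⟩
    (6 * n) ^ 2                  <⟨ ^-monoˡ-< 2 6n<2m ⟩
    (2 * m) ^ 2                  ∎
    where
    eq : ∀ n → 32 * (n * (n * 1)) + 4 * (n * n) ≡ 6 * n * (6 * n * 1)
    eq = solve-∀

-- Here s = K - 1 - r, so 2^s < r² refutes K once r < log(2m/n). That holds because K ≤ 2^(s + 1)
-- means K 2^r ≤ 2^K, which keeps 2^r at most 2 (2^K - 1)/(2K - 1) < 2m/n.
ceil≢-integer : ∀ n m r s → 2 ≤ r → suc (r + s) ≤ 2 ^ suc s → 2 ^ s < r * r →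
  n * (2 ^ suc (r + s) ∸ 1) < suc ((r + s) + (r + s)) * m → ¬ CeilUpperAtMost n m (suc (r + s))
ceil≢-integer n m r s 2≤r K≤ 2^s<r² lt ceil = <⇒≱ too-small (ceil-at n m K r 1 2≤r close ceil)
  where
  open ≤-Reasoning
  K = suc (r + s)
  c = suc ((r + s) + (r + s))
  2^K : 2 ^ K ≡ 2 ^ suc r * 2 ^ s
  2^K = ^-distribˡ-+-* 2 (suc r) s
  c*2^r+2≤ : c * 2 ^ r + 2 ≤ 2 * 2 ^ K
  c*2^r+2≤ = begin
    -- 2^r ≥ 2 pays for the subtracted 1 in 2 * (2^K - 1).
    c * 2 ^ r + 2                ≤⟨ +-monoʳ-≤ (c * 2 ^ r) (^-monoʳ-≤ 2 (≤-trans (s≤s z≤n) 2≤r)) ⟩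
    c * 2 ^ r + 2 ^ r            ≡⟨ eq₁ (r + s) (2 ^ r) ⟩
    2 * (K * 2 ^ r)              ≤⟨ *-monoʳ-≤ 2 (*-monoˡ-≤ (2 ^ r) K≤) ⟩
    2 * (2 ^ suc s * 2 ^ r)      ≡⟨ cong (2 *_) (trans (eq₂ (2 ^ s) (2 ^ r)) (sym 2^K)) ⟩
    2 * 2 ^ K                    ∎
    where
    eq₁ : ∀ k x → (1 + (k + k)) * x + x ≡ 2 * ((1 + k) * x)
    eq₁ = solve-∀
    eq₂ : ∀ x y → 2 * x * y ≡ 2 * y * x
    eq₂ = solve-∀
  c*2^r≤ : c * 2 ^ r ≤ 2 * (2 ^ K ∸ 1)
  c*2^r≤ = ≤-trans (m+n≤o⇒m≤o∸n _ c*2^r+2≤) (≤-reflexive (sym (*-distribˡ-∸ 2 (2 ^ K) 1)))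
  close : 2 ^ r * n ^ 1 < (2 * m) ^ 1
  close = *-cancelˡ-< c _ _ (begin-strict
    c * (2 ^ r * (n * 1))      ≡⟨ eq₁ c (2 ^ r) n ⟩
    n * (c * 2 ^ r)            ≤⟨ *-monoʳ-≤ n c*2^r≤ ⟩
    n * (2 * (2 ^ K ∸ 1))      ≡⟨ eq₂ n (2 ^ K ∸ 1) ⟩
    2 * (n * (2 ^ K ∸ 1))      <⟨ *-monoʳ-< 2 lt ⟩
    2 * (c * m)                ≡⟨ eq₃ c m ⟩
    c * (2 * m * 1)            ∎)
    where
    eq₁ : ∀ c x n → c * (x * (n * 1)) ≡ n * (c * x)
    eq₁ = solve-∀
    eq₂ : ∀ n x → n * (2 * x) ≡ 2 * (n * x)
    eq₂ = solve-∀
    eq₃ : ∀ c m → 2 * (c * m) ≡ c * (2 * m * 1)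
    eq₃ = solve-∀
  too-small : (1 * 1) ^ 1 * 2 ^ (K * 1) < 2 ^ (1 + r) * (r * r) ^ 1
  too-small = begin-strict
    2 ^ (K * 1) + 0            ≡⟨ trans (+-identityʳ _) (cong (2 ^_) (*-identityʳ K)) ⟩
    2 ^ K                      ≡⟨ 2^K ⟩
    2 ^ suc r * 2 ^ s          <⟨ *-monoʳ-< (2 ^ suc r) {{m^n≢0 2 (suc r)}} 2^s<r² ⟩
    2 ^ suc r * (r * r)        ≡⟨ cong (2 ^ suc r *_) (*-identityʳ (r * r)) ⟨
    2 ^ suc r * (r * r * 1)    ∎

-- Needed when K passes the power 2^(s + 1) = r + s + 1: it keeps the incremented s below r.
2s+3≤2^ : ∀ s → 2 ≤ s → s + s + 3 ≤ 2 ^ suc s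
2s+3≤2^ (suc zero) (s≤s ())
2s+3≤2^ (suc (suc zero)) _ = n≤1+n 7
2s+3≤2^ (suc s@(suc (suc _))) _ = begin
  suc s + suc s + 3        ≡⟨ eq s ⟩
  s + s + 3 + 2            ≤⟨ +-mono-≤ (2s+3≤2^ s (s≤s (s≤s z≤n))) (*-monoʳ-≤ 2 (1≤2^ s)) ⟩
  2 ^ suc s + 2 ^ suc s    ≡⟨ cong (λ t → 2 ^ suc s + t) (+-identityʳ (2 ^ suc s)) ⟨
  2 ^ suc (suc s)          ∎
  where
  open ≤-Reasoning
  eq : ∀ s → 1 + s + (1 + s) + 3 ≡ s + s + 3 + 2
  eq = solve-∀

-- r = K − 1 − s refutes K = 6 + j, where s = ⌈log K⌉ − 1.
test-point : ∀ j → ∃₂ λ r s → 6 + j ≡ suc (r + s) × 2 ≤ s × s < r × suc (r + s) ≤ 2 ^ suc s × 2 ^ s < r * r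
test-point zero = 3 , 2 , refl , ≤-refl , ≤-refl , m≤n+m 6 2 , m≤n+m 5 4
test-point (suc j) with r , s , eq , 2≤s , s<r , K≤ , 2^s< ← test-point j with suc (suc (r + s)) ≤? 2 ^ suc s
... | yes K+1≤ = suc r , s , cong suc eq , 2≤s , m<n⇒m<1+n s<r , K+1≤ , <-trans 2^s< (*-mono-< (n<1+n r) (n<1+n r))
-- The old K is exactly 2^(s + 1), so s grows and r stays.
... | no  K+1≰ = r , suc s , trans (cong suc eq) (cong suc (sym (+-suc r s))) , m≤n⇒m≤1+n 2≤s , 1+s<r , K+1≤ , 2^1+s<
  where
  open ≤-Reasoning
  2^≡ : 2 ^ suc s ≡ suc (r + s)
  2^≡ = ≤-antisym (s≤s⁻¹ (≰⇒> K+1≰)) K≤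
  1+s<r : suc s < r
  1+s<r = +-cancelʳ-≤ (suc s) _ _ (begin
    suc (suc s) + suc s    ≡⟨ eq₁ s ⟩
    s + s + 3              ≤⟨ 2s+3≤2^ s 2≤s ⟩
    2 ^ suc s              ≡⟨ 2^≡ ⟩
    suc (r + s)            ≡⟨ +-suc r s ⟨
    r + suc s              ∎)
    where
    eq₁ : ∀ s → 2 + s + (1 + s) ≡ s + s + 3
    eq₁ = solve-∀
  K+1≤ : suc (r + suc s) ≤ 2 ^ suc (suc s)
  K+1≤ = begin
    suc (r + suc s)          ≡⟨ cong suc (trans (+-suc r s) (sym 2^≡)) ⟩
    1 + 2 ^ suc s            ≤⟨ +-mono-≤ (1≤2^ (suc s)) (≤-reflexive (sym (+-identityʳ (2 ^ suc s)))) ⟩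
    2 ^ suc (suc s)          ∎
  2^1+s< : 2 ^ suc s < r * r
  2^1+s< = begin-strict
    2 ^ suc s        ≡⟨ trans 2^≡ (sym (+-suc r s)) ⟩
    r + suc s        <⟨ +-monoʳ-< r 1+s<r ⟩
    r + r            ≡⟨ cong (r +_) (+-identityʳ r) ⟨
    2 * r            ≤⟨ *-monoˡ-≤ r (≤-trans 2≤s (<⇒≤ s<r)) ⟩
    r * r            ∎

large-ceil-fails : ∀ n m k → 2 ≤ k → n * (2 ^ suc k ∸ 1) < suc (k + k) * m → ¬ CeilUpperAtMost n m (suc k)
large-ceil-fails n m (suc zero) (s≤s ())
large-ceil-fails n m 2 _ lt ceil = ceil≢3 n m lt ceil
-- K = 4 admits the integer point r = 2, s = 1.
large-ceil-fails n m 3 _ lt ceil = ceil≢-integer n m 2 1 ≤-refl ≤-refl (n≤1+n 3) lt ceil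
large-ceil-fails n m 4 _ lt ceil = ceil≢5 n m lt ceil
large-ceil-fails n m (suc (suc (suc (suc (suc j))))) _ lt ceil =
  let r , s , eq , 2≤s , s<r , K≤ , 2^s< = test-point j in
  subst (λ k → n * (2 ^ suc k ∸ 1) < suc (k + k) * m → ¬ CeilUpperAtMost n m (suc k))
      (sym (suc-injective eq)) (ceil≢-integer n m r s (≤-trans 2≤s (<⇒≤ s<r)) K≤ 2^s<) lt ceil

upper-bound : ∀ n m K → 1 ≤ n → n < m → m < 2 ^ n → CeilUpperAtMost n m K → Solvable n m (m * K)
upper-bound n m K 1≤n n<m m<2^n ceil = from-3≤ K (3≤ceil n m K 1≤n n<m ceil) ceil
  where
  from-3≤ : ∀ K → 3 ≤ K → CeilUpperAtMost n m K → Solvable n m (m * K)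
  from-3≤ (suc k) (s≤s 2≤k) ceil =
    [ blocks-or-all n m k 1≤n m<2^n
    , (λ lt → contradiction ceil (large-ceil-fails n m k 2≤k lt))
    ]′ (≤-<-connex (suc (k + k) * m) (n * (2 ^ suc k ∸ 1)))

-- The asymptotic form.

ceilDiv*n≤2m : ∀ n m → 1 ≤ n → n < m → ceilDiv m n * n ≤ 2 * m
ceilDiv*n≤2m (suc n) m _ n<m = begin
  (m + n) / suc n * suc n   ≤⟨ m/n*n≤m (m + n) (suc n) ⟩
  m + n                     ≤⟨ +-monoʳ-≤ m (<⇒≤ (<⇒≤ n<m)) ⟩
  m + m                     ≡⟨ cong (m +_) (+-identityʳ m) ⟨
  2 * m                     ∎
  where open ≤-Reasoning

m≤ceilDiv*n : ∀ n m → 1 ≤ n → m ≤ ceilDiv m n * n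
m≤ceilDiv*n (suc n) m _ = +-cancelˡ-≤ n _ _ (begin
  n + m                                              ≡⟨ +-comm n m ⟩
  m + n                                              ≡⟨ m≡m%n+[m/n]*n (m + n) (suc n) ⟩
  (m + n) % suc n + (m + n) / suc n * suc n          ≤⟨ +-monoˡ-≤ _ (s≤s⁻¹ (m%n<n (m + n) (suc n))) ⟩
  n + (m + n) / suc n * suc n                        ∎)
  where open ≤-Reasoning

-- One factor 2^m comes from rounding m/n up, the other from the half of the rows in `averaging`.
ceilDiv^m≤ : ∀ {n m q} → 1 ≤ n → n < m → Solvable n m q → ceilDiv m n ^ m ≤ 2 ^ (q + 2 * m)
ceilDiv^m≤ {n} {m} {q} 1≤n n<m solv =
  let A , covering , averaging = lower-core (≤-trans (s≤s z≤n) n<m) solv in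
  *-cancelʳ-≤ _ _ (n ^ m) {{m^n≢0 n m {{>-nonZero 1≤n}}}} (begin
    c ^ m * n ^ m                      ≡⟨ ^-distribʳ-* m c n ⟨
    (c * n) ^ m                        ≤⟨ ^-monoˡ-≤ m (ceilDiv*n≤2m n m 1≤n n<m) ⟩
    (2 * m) ^ m                        ≡⟨ ^-distribʳ-* m 2 m ⟩
    2 ^ m * m ^ m                      ≤⟨ *-monoʳ-≤ (2 ^ m) (LowerBound.m^m≤n^m*2^[q+m] {n} {m} {q} {A}
                                            covering averaging (≤-trans (s≤s 1≤n) n<m)) ⟩
    2 ^ m * (n ^ m * 2 ^ (q + m))      ≡⟨ eq₁ (2 ^ m) (n ^ m) (2 ^ (q + m)) ⟩
    2 ^ (q + m) * 2 ^ m * n ^ m        ≡⟨ cong (_* n ^ m) (^-distribˡ-+-* 2 (q + m) m) ⟨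
    2 ^ (q + m + m) * n ^ m            ≡⟨ cong (λ t → 2 ^ t * n ^ m) (eq₂ q m) ⟩
    2 ^ (q + 2 * m) * n ^ m            ∎)
  where
  open ≤-Reasoning
  c = ceilDiv m n
  eq₁ : ∀ a b c → a * (b * c) ≡ c * a * b
  eq₁ = solve-∀
  eq₂ : ∀ q m → q + m + m ≡ q + 2 * m
  eq₂ = solve-∀

-- The additive loss 2 in log c - 2 is at most log c / (e + 1) by the assumption on c =
-- `ceilDiv m n`.
asymptotic-lower : ∀ e {n m q} → 1 ≤ n → n < m → 2 ^ (2 * suc e) ≤ ceilDiv m n → Solvable n m q →
  ceilDiv m n ^ (e * m) ≤ 2 ^ (suc e * q)
asymptotic-lower e {n} {m} {q} 1≤n n<m C≤c solv = *-cancelˡ-≤ (2 ^ (2 * m * suc e)) {{m^n≢0 2 (2 * m * suc e)}} (begin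
  2 ^ (2 * m * suc e) * c ^ (e * m)          ≡⟨ cong (λ t → 2 ^ t * c ^ (e * m)) (eq₁ e m) ⟩
  2 ^ (2 * suc e * m) * c ^ (e * m)          ≡⟨ cong (_* c ^ (e * m)) (^-*-assoc 2 (2 * suc e) m) ⟨
  (2 ^ (2 * suc e)) ^ m * c ^ (e * m)        ≤⟨ *-monoˡ-≤ (c ^ (e * m)) (^-monoˡ-≤ m C≤c) ⟩
  c ^ m * c ^ (e * m)                        ≡⟨ ^-distribˡ-+-* c m (e * m) ⟨
  c ^ (suc e * m)                            ≡⟨ cong (c ^_) (*-comm (suc e) m) ⟩
  c ^ (m * suc e)                            ≡⟨ ^-*-assoc c m (suc e) ⟨
  (c ^ m) ^ suc e                            ≤⟨ ^-monoˡ-≤ (suc e) (ceilDiv^m≤ 1≤n n<m solv) ⟩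
  (2 ^ (q + 2 * m)) ^ suc e                  ≡⟨ ^-*-assoc 2 (q + 2 * m) (suc e) ⟩
  2 ^ ((q + 2 * m) * suc e)                  ≡⟨ cong (2 ^_) (eq₂ e q m) ⟩
  2 ^ (2 * m * suc e + suc e * q)            ≡⟨ ^-distribˡ-+-* 2 (2 * m * suc e) (suc e * q) ⟩
  2 ^ (2 * m * suc e) * 2 ^ (suc e * q)      ∎)
  where
  open ≤-Reasoning
  c = ceilDiv m n
  eq₁ : ∀ e m → 2 * m * (1 + e) ≡ 2 * (1 + e) * m
  eq₁ = solve-∀
  eq₂ : ∀ e q m → (q + 2 * m) * (1 + e) ≡ 2 * m * (1 + e) + (1 + e) * q
  eq₂ = solve-∀

⌊log₂⌋ : ∀ c → 1 ≤ c → ∃ λ L → 2 ^ L ≤ c × c < 2 ^ suc L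
⌊log₂⌋ (suc zero)    _ = 0 , ≤-refl , ≤-refl
⌊log₂⌋ (suc c@(suc _)) _ with L , lo , hi ← ⌊log₂⌋ c (s≤s z≤n) with suc c <? 2 ^ suc L
... | yes c+1< = L , m≤n⇒m≤1+n lo , c+1<
... | no  c+1≮ = suc L , ≮⇒≥ c+1≮ , ≤-<-trans hi (^-monoʳ-< 2 (s≤s (s≤s z≤n)) (n<1+n (suc L)))

-- At t = 8 this fails (288 > 256), which explains the 9 in the threshold 2^((e + 1)(9 + e)).
4t[t+1]≤2^t : ∀ t → 9 ≤ t → 4 * (suc t * t) ≤ 2 ^ t
4t[t+1]≤2^t (suc t) 9≤1+t = [ step , base ]′ (m≤n⇒m<n∨m≡n 9≤1+t)
  where
  open ≤-Reasoning
  base : 9 ≡ suc t → 4 * (suc (suc t) * suc t) ≤ 2 ^ suc t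
  base refl = m≤n+m 360 152
  identity : ∀ t j → t ≡ 9 + j → 4 * ((2 + t) * (1 + t)) + 4 * ((1 + t) * (7 + j)) ≡ 2 * (4 * ((1 + t) * t))
  identity _ j refl = lemma j
    where
    lemma : ∀ j → 4 * ((11 + j) * (10 + j)) + 4 * ((10 + j) * (7 + j)) ≡ 2 * (4 * ((10 + j) * (9 + j)))
    lemma = solve-∀
  step : 9 < suc t → 4 * (suc (suc t) * suc t) ≤ 2 ^ suc t
  step (s≤s 9≤t) =
    let j , 9+j≡t = m≤n⇒∃[o]m+o≡n 9≤t in begin
    4 * (suc (suc t) * suc t)                            ≤⟨ m≤m+n _ (4 * (suc t * (7 + j))) ⟩
    4 * (suc (suc t) * suc t) + 4 * (suc t * (7 + j))    ≡⟨ identity t j (sym 9+j≡t) ⟩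
    2 * (4 * (suc t * t))                                ≤⟨ *-monoʳ-≤ 2 (4t[t+1]≤2^t t 9≤t) ⟩
    2 ^ suc t                                            ∎

-- With 2 ^ L ≤ c < 2 ^ (L + 1), blocks of K = L + t columns suffice as soon as 4 K ≤ 2 ^ t,
-- and t = ⌊L / (e + 1)⌋ keeps (e + 1) K ≤ (e + 2) L.
asymptotic-upper : ∀ e {n m} → 1 ≤ n → m < 2 ^ n → 2 ^ (suc e * (9 + e)) ≤ ceilDiv m n →
  ∃ λ K → Solvable n m (m * K) × 2 ^ (suc e * (m * K)) ≤ ceilDiv m n ^ ((suc e + 1) * m)
asymptotic-upper e {n} {m} 1≤n m<2^n C≤c
  with L , lo , hi ← ⌊log₂⌋ (ceilDiv m n) (≤-trans (1≤2^ (suc e * (9 + e))) C≤c)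
  = K , solv , (begin
    2 ^ (suc e * (m * K))          ≤⟨ ^-monoʳ-≤ 2 exps ⟩
    2 ^ (L * ((suc e + 1) * m))    ≡⟨ ^-*-assoc 2 L ((suc e + 1) * m) ⟨
    (2 ^ L) ^ ((suc e + 1) * m)    ≤⟨ ^-monoˡ-≤ ((suc e + 1) * m) lo ⟩
    c ^ ((suc e + 1) * m)          ∎)
  where
  open ≤-Reasoning
  c = ceilDiv m n
  t = L / suc e
  K = L + t

  t*[1+e]≤L : t * suc e ≤ L
  t*[1+e]≤L = m/n*n≤m L (suc e)

  exps : suc e * (m * K) ≤ L * ((suc e + 1) * m)
  exps = begin
    suc e * (m * (L + t))                   ≡⟨ eq₁ e m L t ⟩
    L * (suc e * m) + t * suc e * m         ≤⟨ +-monoʳ-≤ (L * (suc e * m)) (*-monoˡ-≤ m t*[1+e]≤L) ⟩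
    L * (suc e * m) + L * m                 ≡⟨ eq₂ e m L ⟩
    L * ((suc e + 1) * m)                   ∎
    where
    eq₁ : ∀ e m L t → (1 + e) * (m * (L + t)) ≡ L * ((1 + e) * m) + t * (1 + e) * m
    eq₁ = solve-∀
    eq₂ : ∀ e m L → L * ((1 + e) * m) + L * m ≡ L * ((1 + e + 1) * m)
    eq₂ = solve-∀

  C-exponent≤L : suc e * (9 + e) ≤ L
  C-exponent≤L = s≤s⁻¹ (≰⇒> λ 1+L≤ → <⇒≱ hi (≤-trans (^-monoʳ-≤ 2 1+L≤) C≤c))

  9+e≤t : 9 + e ≤ t
  9+e≤t = begin
    9 + e                     ≡⟨ m*n/n≡m (9 + e) (suc e) ⟨
    (9 + e) * suc e / suc e   ≡⟨ cong (_/ suc e) (*-comm (9 + e) (suc e)) ⟩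
    suc e * (9 + e) / suc e   ≤⟨ /-monoˡ-≤ (suc e) C-exponent≤L ⟩
    t                         ∎

  K≤ : K ≤ suc t * t
  K≤ = begin
    L + t                          ≤⟨ +-monoˡ-≤ t (≤-reflexive (m≡m%n+[m/n]*n L (suc e))) ⟩
    L % suc e + t * suc e + t      ≤⟨ +-monoˡ-≤ t (+-monoˡ-≤ (t * suc e) (s≤s⁻¹ (m%n<n L (suc e)))) ⟩
    e + t * suc e + t              ≤⟨ m≤m+n _ 2 ⟩
    e + t * suc e + t + 2          ≡⟨ eq e t ⟩
    -- The summand e of the threshold ensures 2 + e ≤ t, so that K is bounded in terms of t alone.
    suc t * (2 + e)                ≤⟨ *-monoʳ-≤ (suc t) (≤-trans (m≤n+m (2 + e) 7) 9+e≤t) ⟩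
    suc t * t                      ∎
    where
    eq : ∀ e t → e + t * (1 + e) + t + 2 ≡ (1 + t) * (2 + e)
    eq = solve-∀

  4K≤2^t : 4 * K ≤ 2 ^ t
  4K≤2^t = ≤-trans (*-monoʳ-≤ 4 K≤) (4t[t+1]≤2^t t (≤-trans (m≤m+n 9 e) 9+e≤t))

  solv : Solvable n m (m * K)
  solv with K in K≡
  ... | zero  = contradiction (≤-trans (≤-trans (s≤s z≤n) 9+e≤t) (≤-trans (m≤n+m t L) (≤-reflexive K≡))) λ ()
  ... | suc k = blocks-or-all n m k 1≤n m<2^n (begin
    suc (k + k) * m                       ≤⟨ *-monoʳ-≤ (suc (k + k)) (m≤ceilDiv*n n m 1≤n) ⟩
    suc (k + k) * (c * n)                 ≤⟨ *-monoʳ-≤ (suc (k + k)) (*-monoˡ-≤ n (<⇒≤ hi)) ⟩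
    suc (k + k) * (2 ^ suc L * n)         ≡⟨ eq₁ (suc (k + k)) (2 ^ suc L) n ⟩
    n * (suc (k + k) * 2 ^ suc L)         ≤⟨ *-monoʳ-≤ n (m+n≤o⇒m≤o∸n _ fits) ⟩
    n * (2 ^ suc k ∸ 1)                   ∎)
    where
    eq₁ : ∀ a b n → a * (b * n) ≡ n * (a * b)
    eq₁ = solve-∀
    eq₂ : ∀ k x → (1 + (k + k)) * (2 * x) + 2 * x ≡ x * (4 * (1 + k))
    eq₂ = solve-∀
    fits : suc (k + k) * 2 ^ suc L + 1 ≤ 2 ^ suc k
    fits = begin
      suc (k + k) * 2 ^ suc L + 1            ≤⟨ +-monoʳ-≤ _ (1≤2^ (suc L)) ⟩
      suc (k + k) * 2 ^ suc L + 2 ^ suc L    ≡⟨ eq₂ k (2 ^ L) ⟩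
      2 ^ L * (4 * suc k)                    ≤⟨ *-monoʳ-≤ (2 ^ L) (subst (λ K → 4 * K ≤ 2 ^ t) K≡ 4K≤2^t) ⟩
      2 ^ L * 2 ^ t                          ≡⟨ ^-distribˡ-+-* 2 L t ⟨
      2 ^ K                                  ≡⟨ cong (2 ^_) K≡ ⟩
      2 ^ suc k                              ∎

-- Blocks of one column and groups of one row: Cantor's diagonal.
few-rows : ∀ n m → m ≤ n → IsF n m m
few-rows n m m≤n =
  subst (Solvable n m) (*-identityʳ m)
    (blocks-solvable n m 0 n (≤-reflexive (*-identityʳ n))
      (≤-trans m≤n (≤-reflexive (sym (*-identityʳ n))))) ,
  λ q → rows≤queries

theorem3p2 : (∀ (n m : ℕ) → 1 ≤ m → m ≤ n → IsF n m m)
    × (∀ (n m : ℕ) → 1 ≤ n → n < m → m < 2 ^ n →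
    (∀ q → Solvable n m q → LowerBoundHolds n m q)
    × (∀ K → CeilUpperAtMost n m K → Solvable n m (m * K)))
    × (∀ (e : ℕ) → ∃ λ (C : ℕ) → ∀ (n m k : ℕ) → 1 ≤ n → n < m → m < 2 ^ n →
    C ≤ ceilDiv m n → IsF n m k →
    (ceilDiv m n ^ ((suc e ∸ 1) * m) ≤ 2 ^ (suc e * k))
    × (2 ^ (suc e * k) ≤ ceilDiv m n ^ ((suc e + 1) * m)))
theorem3p2 =
  (λ n m _ m≤n → few-rows n m m≤n) ,
  (λ n m 1≤n n<m m<2^n →
    (λ q → lower-bound (≤-trans (s≤s z≤n) n<m)) ,
    (λ K → upper-bound n m K 1≤n n<m m<2^n)) ,
  -- The o-term is a relative error 1 / (e + 1) beyond a threshold; the one required by the upper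
  -- bound also covers the lower bound.
  λ e → 2 ^ (suc e * (9 + e)) , λ n m k 1≤n n<m m<2^n C≤c (solv , minimal) →
    asymptotic-lower e 1≤n n<m (≤-trans (^-monoʳ-≤ 2 (exponent≤ e)) C≤c) solv ,
    (let K , solvK , le = asymptotic-upper e 1≤n m<2^n C≤c in
     ≤-trans (^-monoʳ-≤ 2 (*-monoʳ-≤ (suc e) (minimal (m * K) solvK))) le)
  where
  exponent≤ : ∀ e → 2 * suc e ≤ suc e * (9 + e)
  exponent≤ e = ≤-trans (≤-reflexive (*-comm 2 (suc e))) (*-monoʳ-≤ (suc e) (m≤m+n 2 (7 + e)))
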